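{- For every $\epsilon>0$ there is a $\left(\tfrac{3}{2}+8\sqrt{2}+\epsilon\right)$-approximation algorithm for the GGTSP. That is, for each fixed $\epsilon>0$ there is an algorithm which, on every GGTSP instance with $n$ points, runs in time polynomial in $n$ and outputs a feasible tour $\mathcal{C}$ with $$w(\mathcal{C})\le \left(\tfrac{3}{2}+8\sqrt{2}+\epsilon\right)OPT,$$ where $OPT$ is the weight of an optimal tour of the instance.
   Context: GGTSP (geometric generalized travelling salesman problem in grid clusters). The plane $\mathbb{R}^2$ is divided by the integer grid into $1\times 1$ cells $[a,a+1]\times[b,b+1]$, $a,b\in\mathbb{Z}$. An instance is a finite set $V\subset\mathbb{R}^2$ of $n$ points; each point is assigned to exactly one cell containing it (a point on a cell border is assigned to just one of the neighbouring cells, by any rule). A cell is non-empty if at least one point is assigned to it; instances are assumed to have at least three non-empty cells, so that cycles exist. The edge between two points has weight equal to their Euclidean distance, and the weight $w$ of a graph is the sum of the weights of its edges. A feasible tour is a cycle, whose vertices are points of $V$, containing exactly one point from each non-empty cell; an optimal tour is a feasible tour of minimum weight. Running time is counted with arithmetic operations on, and comparisons of, (sums of) edge weights at unit cost. -}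

module Defs where

open import Algebra.Bundles using (CommutativeRing)
open import Algebra.Structures using (IsCommutativeRing)
import Algebra.Properties.Semiring.Mult as Mult
open import Data.Bool.Base using (Bool; true; false; not; _∧_; if_then_else_)
open import Data.Fin.Base using (Fin; toℕ; fromℕ<)
open import Data.Integer.Base using (ℤ; +_; -[1+_])
open import Data.List.Base using (List; []; _∷_; map; upTo; length)
open import Data.List.Membership.Propositional using (_∈_)
open import Data.List.Relation.Unary.Unique.Propositional using (Unique)
open import Data.Nat.Base as ℕ using (ℕ; suc)
import Data.Nat.Properties as ℕ
open import Data.Product using (_×_; _,_; ∃; ∃!; proj₁; proj₂)
open import Level using (0ℓ)
open import Relation.Binary.Core using (Rel)
import Relation.Binary.Construct.NonStrictToStrict as Strict
open import Relation.Binary.Structures using (IsDecTotalOrder)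
open import Relation.Binary.PropositionalEquality using (_≡_; _≢_)
open import Relation.Nullary using (¬_; yes; no; does)

-- The real numbers, characterised up to isomorphism as a Dedekind-complete
-- ordered field.  The order is decidable, which reflects both the classical
-- reading of ℝ and the unit-cost comparisons of the computation model.
record RealNumbers : Set₁ where
  infix  8 _⁻¹
  infixl 7 _*_
  infixl 6 _+_
  infix  4 _≈_ _≤_
  field
    Carrier           : Set
    _≈_ _≤_           : Rel Carrier 0ℓ
    _+_ _*_           : Carrier → Carrier → Carrier
    -_ _⁻¹            : Carrier → Carrier
    0# 1#             : Carrier
    isCommutativeRing : IsCommutativeRing _≈_ _+_ _*_ -_ 0# 1#
    isDecTotalOrder   : IsDecTotalOrder _≈_ _≤_
    0≉1               : ¬ 0# ≈ 1#
    ⁻¹-inverseʳ       : ∀ x → ¬ x ≈ 0# → x * x ⁻¹ ≈ 1#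
    -- Fixing the junk value keeps division by zero from giving programs
    -- access to an arbitrary real constant.
    ⁻¹-zero           : ∀ x → x ≈ 0# → x ⁻¹ ≈ 0#
    +-monoˡ-≤         : ∀ x y z → x ≤ y → x + z ≤ y + z
    *-nonneg          : ∀ x y → 0# ≤ x → 0# ≤ y → 0# ≤ x * y
    supremum          : ∀ (P : Carrier → Set) → ∃ P →
                        (∃ λ b → ∀ x → P x → x ≤ b) →
                        ∃ λ s → (∀ x → P x → x ≤ s) ×
                                (∀ b → (∀ x → P x → x ≤ b) → s ≤ b)
    -- Square roots already follow from completeness; they are named here only
    -- for convenience.  The value at negative arguments is never used.
    √_                : Carrier → Carrier
    √-nonneg          : ∀ x → 0# ≤ x → 0# ≤ √ x
    √-square          : ∀ x → 0# ≤ x → √ x * √ x ≈ x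

  commutativeRing : CommutativeRing 0ℓ 0ℓ
  commutativeRing = record { isCommutativeRing = isCommutativeRing }

  open CommutativeRing commutativeRing public using (_-_; semiring)
  open IsDecTotalOrder isDecTotalOrder public using (_≤?_)
  open Strict _≈_ _≤_ public using (_<_)

  fromℕ : ℕ → Carrier
  fromℕ n = Mult._×_ semiring n 1#

  -- Classically a consequence of completeness; it is stated because
  -- completeness alone constructively yields only the double negation.
  field
    archimedean : ∀ x → ∃ λ n → x ≤ fromℕ n

  fromℤ : ℤ → Carrier
  fromℤ (+ n)    = fromℕ n
  fromℤ -[1+ n ] = - fromℕ (suc n)

Cell : Set
Cell = ℤ × ℤ

-- Programs of a real RAM with one unbounded memory of naturals and one of
-- reals.  Programs are finite syntax and contain no real constants other than
-- integers; there is no conversion from reals to naturals.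

infixl 6 _⊕_ _⊖_
infixl 7 _⊗_ _⊘_
infix  4 _≤ᴺ_ _≤ᴿ_
infixr 2 _﹔_
infix  3 N[_]≔_ R[_]≔_

data NExp : Set where
  nat     : ℕ → NExp
  size    : NExp                  -- the number of input points
  N[_]    : NExp → NExp
  _⊕_ _⊖_ : NExp → NExp → NExp    -- ⊖ is truncated subtraction

data RExp : Set where
  int             : ℤ → RExp
  R[_]            : NExp → RExp
  xcoord ycoord   : NExp → RExp   -- coordinates of a point
  xcell ycell     : NExp → RExp   -- lower left corner of the cell of a point
  edge            : NExp → NExp → RExp
  _⊕_ _⊖_ _⊗_ _⊘_ : RExp → RExp → RExp

data BExp : Set where
  _≤ᴺ_ : NExp → NExp → BExp
  _≤ᴿ_ : RExp → RExp → BExp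
  notᴮ : BExp → BExp
  andᴮ : BExp → BExp → BExp

data Program : Set where
  skip              : Program
  N[_]≔_            : NExp → NExp → Program
  R[_]≔_            : NExp → RExp → Program
  _﹔_              : Program → Program → Program
  if′_then′_else′_  : BExp → Program → Program → Program
  while′_do′_       : BExp → Program → Program

module GGTSP (ℝ : RealNumbers) where
  open RealNumbers ℝ

  Point : Set
  Point = Carrier × Carrier

  dist : Point → Point → Carrier
  dist (x , y) (x′ , y′) = √ ((x - x′) * (x - x′) + (y - y′) * (y - y′))

  _InCell_ : Point → Cell → Set
  (x , y) InCell (a , b) =
    (fromℤ a ≤ x × x ≤ fromℤ a + 1#) × (fromℤ b ≤ y × y ≤ fromℤ b + 1#)

  record Instance : Set where
    field
      n          : ℕ
      point      : Fin n → Point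
      distinct   : ∀ i j → proj₁ (point i) ≈ proj₁ (point j) →
                           proj₂ (point i) ≈ proj₂ (point j) → i ≡ j
      cell       : Fin n → Cell
      inCell     : ∀ i → point i InCell cell i
      threeCells : ∃ λ i → ∃ λ j → ∃ λ k →
                   cell i ≢ cell j × cell j ≢ cell k × cell i ≢ cell k

    weight : Fin n → Fin n → Carrier
    weight i j = dist (point i) (point j)

    NonEmpty : Cell → Set
    NonEmpty c = ∃ λ i → cell i ≡ c

  module _ (I : Instance) where
    open Instance I

    -- A cycle, as the list of its vertices in cyclic order.
    record Cycle : Set where
      field
        vertices : List (Fin n)
        unique   : Unique vertices
        3≤length : 3 ℕ.≤ length vertices

    open Cycle public

    private
      closing : Fin n → Fin n → List (Fin n) → Carrier
      closing start v []       = weight v start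
      closing start v (u ∷ us) = weight v u + closing start u us

    cyclicWeight : List (Fin n) → Carrier
    cyclicWeight []       = 0#
    cyclicWeight (v ∷ vs) = closing v v vs

    w : Cycle → Carrier
    w C = cyclicWeight (vertices C)

    Feasible : Cycle → Set
    Feasible C = ∀ c → NonEmpty c → ∃! _≡_ λ v → v ∈ vertices C × cell v ≡ c

    Optimal : Cycle → Set
    Optimal T = Feasible T × (∀ T′ → Feasible T′ → w T ≤ w T′)

  record State : Set where
    constructor ⟨_,_⟩
    field
      natMem  : ℕ → ℕ
      realMem : ℕ → Carrier

  open State public

  initial : State
  initial = ⟨ (λ _ → 0) , (λ _ → 0#) ⟩

  _[_↦_] : {A : Set} → (ℕ → A) → ℕ → A → (ℕ → A)
  (m [ k ↦ v ]) l = if does (l ℕ.≟ k) then v else m l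

  module Semantics (I : Instance) where
    open Instance I

    -- Input reads at an index that is not a point return 0.
    atPoint : (Fin n → Carrier) → ℕ → Carrier
    atPoint f k with k ℕ.<? n
    ... | yes k<n = f (fromℕ< k<n)
    ... | no  _   = 0#

    evalN : State → NExp → ℕ
    evalN s (nat k) = k
    evalN s size    = n
    evalN s N[ e ]  = natMem s (evalN s e)
    evalN s (e ⊕ f) = evalN s e ℕ.+ evalN s f
    evalN s (e ⊖ f) = evalN s e ℕ.∸ evalN s f

    evalR : State → RExp → Carrier
    evalR s (int z)    = fromℤ z
    evalR s R[ e ]     = realMem s (evalN s e)
    evalR s (xcoord e) = atPoint (λ i → proj₁ (point i)) (evalN s e)
    evalR s (ycoord e) = atPoint (λ i → proj₂ (point i)) (evalN s e)
    evalR s (xcell e)  = atPoint (λ i → fromℤ (proj₁ (cell i))) (evalN s e)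
    evalR s (ycell e)  = atPoint (λ i → fromℤ (proj₂ (cell i))) (evalN s e)
    evalR s (edge e f) =
      atPoint (λ i → atPoint (λ j → weight i j) (evalN s f)) (evalN s e)
    evalR s (e ⊕ f)    = evalR s e + evalR s f
    evalR s (e ⊖ f)    = evalR s e - evalR s f
    evalR s (e ⊗ f)    = evalR s e * evalR s f
    evalR s (e ⊘ f)    = evalR s e * evalR s f ⁻¹

    evalB : State → BExp → Bool
    evalB s (e ≤ᴺ f)   = does (evalN s e ℕ.≤? evalN s f)
    evalB s (e ≤ᴿ f)   = does (evalR s e ≤? evalR s f)
    evalB s (notᴮ b)   = not (evalB s b)
    evalB s (andᴮ b c) = evalB s b ∧ evalB s c

    -- Run p s t s′ : started in s, the program p halts in s′ after t steps.
    -- A step is one assignment, skip or test; as the expressions occurring in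
    -- a program are fixed, counting every operation separately would change t
    -- by at most a constant factor depending only on the program.
    data Run : Program → State → ℕ → State → Set where
      run-skip  : ∀ {s} → Run skip s 1 s
      run-nat   : ∀ {s a e} →
                  Run (N[ a ]≔ e) s 1
                      ⟨ natMem s [ evalN s a ↦ evalN s e ] , realMem s ⟩
      run-real  : ∀ {s a e} →
                  Run (R[ a ]≔ e) s 1
                      ⟨ natMem s , realMem s [ evalN s a ↦ evalR s e ] ⟩
      run-seq   : ∀ {p q s s′ s″ t t′} →
                  Run p s t s′ → Run q s′ t′ s″ → Run (p ﹔ q) s (t ℕ.+ t′) s″
      run-then  : ∀ {b p q s s′ t} → evalB s b ≡ true →
                  Run p s t s′ → Run (if′ b then′ p else′ q) s (suc t) s′
      run-else  : ∀ {b p q s s′ t} → evalB s b ≡ false →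
                  Run q s t s′ → Run (if′ b then′ p else′ q) s (suc t) s′
      run-done  : ∀ {b p s} → evalB s b ≡ false →
                  Run (while′ b do′ p) s 1 s
      run-loop  : ∀ {b p s s′ s″ t t′} → evalB s b ≡ true →
                  Run p s t s′ → Run (while′ b do′ p) s′ t′ s″ →
                  Run (while′ b do′ p) s (suc (t ℕ.+ t′)) s″

    -- The output is a list of naturals: its length is in cell 0 of the memory
    -- of naturals and its entries are in the cells that follow.
    output : State → List ℕ
    output s = map (λ k → natMem s (suc k)) (upTo (natMem s 0))

  Outputs : Program → (I : Instance) → ℕ → Cycle I → Set
  Outputs p I t C = ∃ λ s → Run p initial t s × output s ≡ map toℕ (vertices C)
    where open Semantics I

  -- p is an approximation algorithm with ratio ρ whose running time is
  -- polynomial in the number of points (bounded by a * n ^ d; note 3 ≤ n).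
  IsApproximationAlgorithm : Carrier → Program → Set
  IsApproximationAlgorithm ρ p =
    ∃ λ a → ∃ λ d → ∀ (I : Instance) →
    ∃ λ t → ∃ λ (C : Cycle I) →
      t ℕ.≤ a ℕ.* Instance.n I ℕ.^ d ×
      Outputs p I t C ×
      Feasible I C ×
      (∀ T → Optimal I T → w I C ≤ ρ * w I T)

{-# OPTIONS --safe #-}
-- The algorithm grows a tour from a root r: while some cell is unvisited, it
-- takes the lightest edge from a tour vertex u to any point v of an unvisited
-- cell and inserts v right after u; it does so for every root and keeps the
-- tour whose chosen edges have the least total weight M.  Each insertion costs
-- at most twice its edge, so the tour weighs at most 2M.  Compare with a
-- feasible tour C of weight L through N points, and take r on C.  Each chosen
-- edge is at most as heavy as the edge from r to a point of C, hence at most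
-- L/2, and so 2M ≤ (N − 1) L, which suffices for N ≤ 7.  In general a chosen
-- edge weighs at most √2 more than any edge of C that joins a visited cell to
-- an unvisited one, and as in Prim's algorithm M ≤ L + √2 N follows.  Finally
-- eight consecutive points of C span a path of length at least 2: two of them
-- lie three rows or columns apart, or their cells occupy at least three corners
-- of a 3×3 square.  Hence 2N ≤ 7L when N ≥ 8, and the ratio 2 + 7√2 is reached.

module Submission where

open import Defs
open import Algebra.Bundles using (CommutativeRing)
import Algebra.Properties.Ring as RingProperties
import Algebra.Solver.Ring.NaturalCoefficients.Default as SemiringSolver
open import Data.Bool.Base using (Bool; true; false; not; _∧_)
open import Data.Fin.Base using (Fin; toℕ; fromℕ<)
import Data.Fin.Properties as Fin
open import Data.Integer.Base as ℤ using (ℤ; +_; -[1+_])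
import Data.Integer.Properties as ℤ
open import Data.List.Base using (List; []; _∷_; _++_; [_]; map; length; filter; take; upTo; applyUpTo)
import Data.List.Extrema as Extrema
open import Data.List.Membership.Propositional using (_∈_; find; lose)
open import Data.List.Membership.Propositional.Properties
  using (∈-map⁺; ∈-map⁻; ∈-filter⁻; ∈-∃++; ∈-++⁺ˡ; ∈-++⁺ʳ; ∈-++⁻; ∈-insert; ∈-allFin)
import Data.List.Properties as List
open import Data.List.Relation.Binary.Permutation.Propositional using (_↭_; ↭-sym; ↭-trans; ↭⇒↭ₛ)
open import Data.List.Relation.Binary.Permutation.Propositional.Properties
  using (shift; ↭-length; map⁺; ++-comm; ∈-resp-↭)
import Data.List.Relation.Binary.Permutation.Setoid.Properties as Permutation
open import Data.List.Relation.Binary.Sublist.Propositional as Sublist using (_⊆_; []; _∷_; _∷ʳ_)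
open import Data.List.Relation.Binary.Sublist.Propositional.Properties using (filter-⊆)
open import Data.List.Relation.Unary.All as All using (All; []; _∷_)
open import Data.List.Relation.Unary.AllPairs as AllPairs using ([]; _∷_)
open import Data.List.Relation.Unary.Any using (here; there; any?)
open import Data.List.Relation.Unary.Unique.Propositional using (Unique)
import Data.List.Relation.Unary.Unique.Propositional.Properties as Unique
open import Data.Nat.Base as ℕ using (ℕ; zero; suc)
import Data.Nat.Properties as ℕ
open import Data.Product using (_×_; _,_; ∃; proj₁; proj₂)
open import Data.Product.Properties using (≡-dec)
open import Data.Sum.Base using (_⊎_; inj₁; inj₂)
open import Data.Unit.Base using (⊤; tt)
open import Function.Base using (_∘_)
open import Relation.Binary.Bundles using (DecTotalOrder)
open import Relation.Binary.PropositionalEquality as ≡ using (_≡_; _≢_)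
import Relation.Binary.Reasoning.PartialOrder as PosetReasoning
open import Relation.Nullary using (¬_; Dec; yes; no; does; contradiction)
open import Relation.Nullary.Decidable using (¬?; _⊎-dec_; dec-true; dec-false)

-- The obstacle is that the chosen edges end at arbitrary points of their cells while `C` passes
-- through other points of the same cells. One cell diagonal √2 is lost per comparison, not two: a
-- tour vertex stands in for the vertex of `C` in its cell, but the far end of the compared edge may
-- lie on `C` itself, since every point of an unvisited cell is a candidate. The total loss √2 N has
-- to be paid by L, and this fails for few points: up to four cells meet in a grid corner, and L can
-- be arbitrarily small. There the star around a root on `C` loses no diagonal at all; since `C` is
-- unknown, every point is tried as root. The Prim-like bound needs no exchange of tree edges. The
-- visited cells cut `C` into gaps, each of which may do without one edge. A newly visited vertex
-- splits its gap and so allows one more edge to be dropped, and this edge can always be chosen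
-- between a visited and an unvisited cell, where it is heavy enough to pay for the edge just
-- chosen.

-- Counting in lists and integers

unique-⊆⇒length-≤ : {A : Set} {xs ys : List A} → Unique xs → (∀ {x} → x ∈ xs → x ∈ ys) → length xs ℕ.≤ length ys
unique-⊆⇒length-≤ {xs = []} _ _ = ℕ.z≤n
unique-⊆⇒length-≤ {xs = x ∷ xs} (x∉xs ∷ xs!) xs⊆ys with ∈-∃++ (xs⊆ys (here ≡.refl))
... | as , bs , ≡.refl = ≡.subst (suc (length xs) ℕ.≤_) (≡.sym (↭-length (shift x as bs)))
    (ℕ.s≤s (unique-⊆⇒length-≤ xs! λ {z} z∈xs → drop-x z∈xs (∈-resp-↭ (shift x as bs) (xs⊆ys (there z∈xs)))))
  where
  drop-x : ∀ {z zs} → z ∈ xs → z ∈ x ∷ zs → z ∈ zs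
  drop-x z∈xs (here ≡.refl) = contradiction ≡.refl (All.lookup x∉xs z∈xs)
  drop-x z∈xs (there z∈zs)  = z∈zs

-- The difference is made a natural number, so that matching separates the three admissible values
-- from the rest.
within-two : ∀ {α a} → α ℤ.≤ a → ¬ α ℤ.+ + 3 ℤ.≤ a → a ≡ α ⊎ a ≡ α ℤ.+ + 1 ⊎ a ≡ α ℤ.+ + 2
within-two {α} {a} α≤a ¬far = go ℤ.∣ a ℤ.- α ∣ α+k≡a
  where
  α+k≡a : α ℤ.+ + ℤ.∣ a ℤ.- α ∣ ≡ a
  α+k≡a = ≡.trans (≡.cong (λ z → α ℤ.+ z) (ℤ.0≤i⇒+∣i∣≡i (ℤ.i≤j⇒0≤j-i α≤a)))
    (≡.trans (ℤ.+-comm α _) (≡.trans (ℤ.+-assoc a _ α)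
      (≡.trans (≡.cong (λ z → a ℤ.+ z) (ℤ.+-inverseˡ α)) (ℤ.+-identityʳ a))))
  go : ∀ k → α ℤ.+ + k ≡ a → a ≡ α ⊎ a ≡ α ℤ.+ + 1 ⊎ a ≡ α ℤ.+ + 2
  go 0 eq = inj₁ (≡.trans (≡.sym eq) (ℤ.+-identityʳ α))
  go 1 eq = inj₂ (inj₁ (≡.sym eq))
  go 2 eq = inj₂ (inj₂ (≡.sym eq))
  go (suc (suc (suc k))) eq = contradiction
    (≡.subst (α ℤ.+ + 3 ℤ.≤_) eq (ℤ.+-monoʳ-≤ α (ℤ.+≤+ (ℕ.s≤s (ℕ.s≤s (ℕ.s≤s ℕ.z≤n)))))) ¬far

length-filter-¬ : {A : Set} {P : A → Set} (P? : ∀ x → Dec (P x)) → ∀ xs →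
                  length (filter P? xs) ℕ.+ length (filter (¬? ∘ P?) xs) ≡ length xs
length-filter-¬ P? []       = ≡.refl
length-filter-¬ P? (x ∷ xs) with P? x
... | yes _ = ≡.cong suc (length-filter-¬ P? xs)
... | no  _ = ≡.trans (ℕ.+-suc _ _) (≡.cong suc (length-filter-¬ P? xs))

-- The program

for_upTo_do′_ : ℕ → NExp → Program → Program
for r upTo b do′ p = N[ nat r ]≔ nat 0 ﹔ while′ nat 1 ⊕ N[ nat r ] ≤ᴺ b do′ (p ﹔ N[ nat r ]≔ nat 1 ⊕ N[ nat r ])

-- Cells are available to the machine only as real corner coordinates, so equality is tested by two
-- comparisons per coordinate.
sameCell : NExp → NExp → BExp
sameCell u v = andᴮ (andᴮ (xcell u ≤ᴿ xcell v) (xcell v ≤ᴿ xcell u))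
                    (andᴮ (ycell u ≤ᴿ ycell v) (ycell v ≤ᴿ ycell u))

-- Naturals: 1 root, 2 round, 3 candidate point, 4 position, 5 "candidate is
-- covered", 6 "an edge has been found", 7 its position, 8 its new point,
-- 9 length of the tour, 10 "some tour has been saved", 11–13 insertion; the
-- tour starts at 16; the saved tour has its length at 16 + n and its vertices
-- from 17 + n.  Reals: 0 weight of the edge found, 1 weight of the edges
-- chosen, 2 that of the saved tour.
tourAt : NExp → NExp
tourAt e = N[ nat 16 ⊕ e ]

markCovered : Program
markCovered = for 4 upTo N[ nat 9 ] do′
  (if′ sameCell (tourAt N[ nat 4 ]) N[ nat 3 ] then′ N[ nat 5 ]≔ nat 1 else′ skip)

-- Register 6 stands in for an infinite initial minimum: while it is 0, the stale content of real 0
-- has no influence.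
improveEdge : Program
improveEdge = for 4 upTo N[ nat 9 ] do′
  (if′ notᴮ (andᴮ (nat 1 ≤ᴺ N[ nat 6 ]) (R[ nat 0 ] ≤ᴿ edge (tourAt N[ nat 4 ]) N[ nat 3 ]))
   then′ (N[ nat 6 ]≔ nat 1 ﹔ N[ nat 7 ]≔ N[ nat 4 ] ﹔ N[ nat 8 ]≔ N[ nat 3 ] ﹔
          R[ nat 0 ]≔ edge (tourAt N[ nat 4 ]) N[ nat 3 ])
   else′ skip)

nearestEdge : Program
nearestEdge = N[ nat 6 ]≔ nat 0 ﹔ for 3 upTo size do′
  (N[ nat 5 ]≔ nat 0 ﹔ markCovered ﹔ (if′ N[ nat 5 ] ≤ᴺ nat 0 then′ improveEdge else′ skip))

shiftOne : Program
shiftOne = N[ nat 13 ]≔ tourAt N[ nat 11 ] ﹔ N[ nat 16 ⊕ N[ nat 11 ] ]≔ N[ nat 12 ] ﹔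
           N[ nat 12 ]≔ N[ nat 13 ] ﹔ N[ nat 11 ]≔ nat 1 ⊕ N[ nat 11 ]

insertPoint : Program
insertPoint = N[ nat 11 ]≔ nat 1 ⊕ N[ nat 7 ] ﹔ N[ nat 12 ]≔ N[ nat 8 ] ﹔ N[ nat 9 ]≔ nat 1 ⊕ N[ nat 9 ] ﹔
  (while′ nat 1 ⊕ N[ nat 11 ] ≤ᴺ N[ nat 9 ] do′ shiftOne) ﹔ R[ nat 1 ]≔ R[ nat 1 ] ⊕ R[ nat 0 ]

growTour : Program
growTour = N[ nat 16 ]≔ N[ nat 1 ] ﹔ N[ nat 9 ]≔ nat 1 ﹔ R[ nat 1 ]≔ int (+ 0) ﹔ for 2 upTo size do′
  (nearestEdge ﹔ (if′ nat 1 ≤ᴺ N[ nat 6 ] then′ insertPoint else′ skip))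

saveTour : Program
saveTour = if′ notᴮ (andᴮ (nat 1 ≤ᴺ N[ nat 10 ]) (R[ nat 2 ] ≤ᴿ R[ nat 1 ]))
  then′ (N[ nat 10 ]≔ nat 1 ﹔ R[ nat 2 ]≔ R[ nat 1 ] ﹔ N[ nat 16 ⊕ size ]≔ N[ nat 9 ] ﹔
         (for 4 upTo N[ nat 9 ] do′ (N[ nat 17 ⊕ size ⊕ N[ nat 4 ] ]≔ tourAt N[ nat 4 ])))
  else′ skip

-- The loop counter is register 0 on purpose: when the loop stops it equals the number of copied
-- vertices, which is where the output format expects the length.
returnTour : Program
returnTour = for 0 upTo N[ nat 16 ⊕ size ] do′ (N[ nat 1 ⊕ N[ nat 0 ] ]≔ N[ nat 17 ⊕ size ⊕ N[ nat 0 ] ])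

greedyProgram : Program
greedyProgram = (for 1 upTo size do′ (growTour ﹔ saveTour)) ﹔ returnTour

-- Polynomial running time

-- The time of p if each of its loops is iterated at most n times.
cost : ℕ → Program → ℕ
cost n skip                      = 1
cost n (N[ a ]≔ e)               = 1
cost n (R[ a ]≔ e)               = 1
cost n (p ﹔ q)                  = cost n p ℕ.+ cost n q
cost n (if′ b then′ p else′ q)   = suc (cost n p ℕ.+ cost n q)
cost n (while′ b do′ p)          = suc (n ℕ.* suc (cost n p))

-- Adding the exponents of two parts is wasteful but spares a maximum; `1 ≤ n` makes powers monotone
-- in the exponent.
cost-polynomial : ∀ p → ∃ λ a → ∃ λ d → ∀ n → 1 ℕ.≤ n → cost n p ℕ.≤ a ℕ.* n ℕ.^ d
cost-polynomial = go
  where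
  open ℕ.≤-Reasoning
  1≤^ : ∀ {n} d → 1 ℕ.≤ n → 1 ℕ.≤ n ℕ.^ d
  1≤^ {n} d 1≤n = ℕ.≤-trans (ℕ.≤-reflexive (≡.sym (ℕ.^-zeroˡ d))) (ℕ.^-monoˡ-≤ d 1≤n)
  ^-monoʳ : ∀ {n d e} → 1 ℕ.≤ n → d ℕ.≤ e → n ℕ.^ d ℕ.≤ n ℕ.^ e
  ^-monoʳ {suc n} _ d≤e = ℕ.^-monoʳ-≤ (suc n) d≤e
  pair : ∀ {n c c′} a d a′ d′ → 1 ℕ.≤ n → c ℕ.≤ a ℕ.* n ℕ.^ d → c′ ℕ.≤ a′ ℕ.* n ℕ.^ d′ →
         c ℕ.+ c′ ℕ.≤ (a ℕ.+ a′) ℕ.* n ℕ.^ (d ℕ.+ d′)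
  pair {n} {c} {c′} a d a′ d′ 1≤n c≤ c′≤ = begin
    c ℕ.+ c′                                                        ≤⟨ ℕ.+-mono-≤ c≤ c′≤ ⟩
    a ℕ.* n ℕ.^ d ℕ.+ a′ ℕ.* n ℕ.^ d′
      ≤⟨ ℕ.+-mono-≤ (ℕ.*-monoʳ-≤ a (^-monoʳ 1≤n (ℕ.m≤m+n d d′))) (ℕ.*-monoʳ-≤ a′ (^-monoʳ 1≤n (ℕ.m≤n+m d′ d))) ⟩
    a ℕ.* n ℕ.^ (d ℕ.+ d′) ℕ.+ a′ ℕ.* n ℕ.^ (d ℕ.+ d′)              ≡⟨ ℕ.*-distribʳ-+ _ a a′ ⟨
    (a ℕ.+ a′) ℕ.* n ℕ.^ (d ℕ.+ d′)                                 ∎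
  1+ : ∀ {n c} a d → 1 ℕ.≤ n → c ℕ.≤ a ℕ.* n ℕ.^ d → suc c ℕ.≤ suc a ℕ.* n ℕ.^ d
  1+ a d 1≤n c≤ = ℕ.+-mono-≤ (1≤^ d 1≤n) c≤
  go : ∀ p → ∃ λ a → ∃ λ d → ∀ n → 1 ℕ.≤ n → cost n p ℕ.≤ a ℕ.* n ℕ.^ d
  go skip        = 1 , 0 , λ _ _ → ℕ.≤-refl
  go (N[ a ]≔ e) = 1 , 0 , λ _ _ → ℕ.≤-refl
  go (R[ a ]≔ e) = 1 , 0 , λ _ _ → ℕ.≤-refl
  go (p ﹔ q) with go p | go q
  ... | a , d , p≤ | a′ , d′ , q≤ = a ℕ.+ a′ , d ℕ.+ d′ , λ n 1≤n → pair a d a′ d′ 1≤n (p≤ n 1≤n) (q≤ n 1≤n)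
  go (if′ b then′ p else′ q) with go p | go q
  ... | a , d , p≤ | a′ , d′ , q≤ =
    suc (a ℕ.+ a′) , d ℕ.+ d′ , λ n 1≤n → 1+ (a ℕ.+ a′) (d ℕ.+ d′) 1≤n (pair a d a′ d′ 1≤n (p≤ n 1≤n) (q≤ n 1≤n))
  go (while′ b do′ p) with go p
  ... | a , d , p≤ = suc (suc a) , suc d , λ n 1≤n → 1+ (suc a) (suc d) 1≤n (begin
    n ℕ.* suc (cost n p)            ≤⟨ ℕ.*-monoʳ-≤ n (1+ a d 1≤n (p≤ n 1≤n)) ⟩
    n ℕ.* (suc a ℕ.* n ℕ.^ d)       ≡⟨ ℕ.*-assoc n (suc a) _ ⟨
    n ℕ.* suc a ℕ.* n ℕ.^ d         ≡⟨ ≡.cong (ℕ._* n ℕ.^ d) (ℕ.*-comm n (suc a)) ⟩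
    suc a ℕ.* n ℕ.* n ℕ.^ d         ≡⟨ ℕ.*-assoc (suc a) n _ ⟩
    suc a ℕ.* n ℕ.^ suc d           ∎)

-- Decisions and positions in lists

does-true : {P : Set} (d : Dec P) → does d ≡ true → P
does-true (yes p) _ = p

does-false : {P : Set} (d : Dec P) → does d ≡ false → ¬ P
does-false (no ¬p) _ = ¬p

∧-true : ∀ {a b} → a ∧ b ≡ true → a ≡ true × b ≡ true
∧-true {true} {true} _ = ≡.refl , ≡.refl

not-false : ∀ {a} → not a ≡ false → a ≡ true
not-false {true} _ = ≡.refl

split-at : {A : Set} (xs : List A) {i : ℕ} → i ℕ.< length xs →
           ∃ λ as → ∃ λ x → ∃ λ bs → xs ≡ as ++ x ∷ bs × i ≡ length as
split-at (x ∷ xs) {zero}  _            = [] , x , xs , ≡.refl , ≡.refl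
split-at (x ∷ xs) {suc i} (ℕ.s≤s i<) with split-at xs i<
... | as , y , bs , ≡.refl , eq = x ∷ as , y , bs , ≡.refl , ≡.cong suc eq

same-position : {A : Set} (as as′ : List A) {x x′ : A} {bs bs′ : List A} →
                as ++ x ∷ bs ≡ as′ ++ x′ ∷ bs′ → length as ≡ length as′ → x ≡ x′
same-position []       []         eq _  = List.∷-injectiveˡ eq
same-position (_ ∷ as) (_ ∷ as′)  eq le = same-position as as′ (List.∷-injectiveʳ eq) (ℕ.suc-injective le)

-- Made for invariants of loops over the tour: by `seen-suc` one more iteration adds exactly the
-- entry just inspected.
Seen : {A : Set} → List A → ℕ → A → Set
Seen xs k u = ∃ λ as → ∃ λ bs → xs ≡ as ++ u ∷ bs × length as ℕ.< k

seen-suc : {A : Set} (as : List A) {x : A} {bs : List A} {u : A} →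
           Seen (as ++ x ∷ bs) (suc (length as)) u → Seen (as ++ x ∷ bs) (length as) u ⊎ u ≡ x
seen-suc as (as′ , bs′ , eq , le) with ℕ.m≤n⇒m<n∨m≡n (ℕ.≤-pred le)
... | inj₁ lt = inj₁ (as′ , bs′ , eq , lt)
... | inj₂ e  = inj₂ (≡.sym (same-position as as′ eq (≡.sym e)))

∈⇒seen : {A : Set} {xs : List A} {u : A} → u ∈ xs → Seen xs (length xs) u
∈⇒seen u∈ with ∈-∃++ u∈
... | as , bs , ≡.refl = as , bs , ≡.refl , ℕ.≤-trans (ℕ.m<m+n (length as) ℕ.z<s) (ℕ.≤-reflexive (≡.sym (List.length-++ as)))

seen-0 : {A : Set} {xs : List A} {u : A} → ¬ Seen xs 0 u
seen-0 (_ , _ , _ , ())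

unique-map : {A B : Set} (f : A → B) {xs : List A} → (∀ {x y} → x ∈ xs → y ∈ xs → f x ≡ f y → x ≡ y) →
             Unique xs → Unique (map f xs)
unique-map f inj []          = []
unique-map f inj (x∉ ∷ xs!)  = All.tabulate (λ y∈ eq → let (z , z∈ , eq′) = ∈-map⁻ f y∈ in
    All.lookup x∉ z∈ (inj (here ≡.refl) (there z∈) (≡.trans eq eq′)))
  ∷ unique-map f (λ x∈ y∈ → inj (there x∈) (there y∈)) xs!

module OverReals (ℝ : RealNumbers) where
  open RealNumbers ℝ
  open GGTSP ℝ
  open CommutativeRing commutativeRing
    using (+-cong; +-congˡ; +-congʳ; *-cong; *-congˡ; *-congʳ; +-comm; +-assoc; +-identityˡ; +-identityʳ;
           *-comm; *-assoc; *-identityˡ; *-identityʳ; distribˡ; distribʳ;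
           zeroˡ; -‿cong; -‿inverseʳ; -‿inverseˡ; commutativeSemiring; ring; refl; sym; trans)

  -- Arithmetic in an ordered field

  decTotalOrder : DecTotalOrder _ _ _
  decTotalOrder = record { isDecTotalOrder = isDecTotalOrder }

  open DecTotalOrder decTotalOrder
    using (total; antisym; poset; _≟_)
    renaming (reflexive to ≤-reflexive; trans to ≤-trans; refl to ≤-refl)
  open SemiringSolver commutativeSemiring using (solve; _:=_; _:+_; _:*_; con)
  open RingProperties ring using (-‿distribˡ-*; -‿distribʳ-*; -‿involutive; -‿+-comm)
  module ≤-Reasoning = PosetReasoning poset
  open ≤-Reasoning

  2# : Carrier
  2# = fromℕ 2

  +-mono-≤ : ∀ {x y u v} → x ≤ y → u ≤ v → x + u ≤ y + v
  +-mono-≤ {x} {y} {u} {v} x≤y u≤v = begin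
    x + u ≤⟨ +-monoˡ-≤ x y u x≤y ⟩
    y + u ≈⟨ +-comm y u ⟩
    u + y ≤⟨ +-monoˡ-≤ u v y u≤v ⟩
    v + y ≈⟨ +-comm v y ⟩
    y + v ∎

  +-nonneg : ∀ {x y} → 0# ≤ x → 0# ≤ y → 0# ≤ x + y
  +-nonneg 0≤x 0≤y = ≤-trans (≤-reflexive (sym (+-identityˡ 0#))) (+-mono-≤ 0≤x 0≤y)

  x≤x+y : ∀ {x y} → 0# ≤ y → x ≤ x + y
  x≤x+y {x} 0≤y = ≤-trans (≤-reflexive (sym (+-identityʳ x))) (+-mono-≤ ≤-refl 0≤y)

  x≤y+x : ∀ {x y} → 0# ≤ y → x ≤ y + x
  x≤y+x 0≤y = ≤-trans (x≤x+y 0≤y) (≤-reflexive (+-comm _ _))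

  x+[y-x]≈y : ∀ x y → x + (y - x) ≈ y
  x+[y-x]≈y x y = begin-equality
    x + (y - x)   ≈⟨ solve 3 (λ x y z → x :+ (y :+ z) := y :+ (x :+ z)) refl x y (- x) ⟩
    y + (x - x)   ≈⟨ +-congˡ (-‿inverseʳ x) ⟩
    y + 0#        ≈⟨ +-identityʳ y ⟩
    y             ∎

  +-cancelʳ-≤ : ∀ {x y} z → x + z ≤ y + z → x ≤ y
  +-cancelʳ-≤ {x} {y} z x+z≤y+z = begin
    x             ≈⟨ cancel x ⟨
    x + z + - z   ≤⟨ +-monoˡ-≤ _ _ (- z) x+z≤y+z ⟩
    y + z + - z   ≈⟨ cancel y ⟩
    y             ∎
    where
    cancel : ∀ x → x + z + - z ≈ x
    cancel x = trans (+-assoc x z (- z)) (trans (+-congˡ (-‿inverseʳ z)) (+-identityʳ x))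

  ≤⇒0≤- : ∀ {x y} → x ≤ y → 0# ≤ y - x
  ≤⇒0≤- {x} {y} x≤y = ≤-trans (≤-reflexive (sym (-‿inverseʳ x))) (+-monoˡ-≤ x y (- x) x≤y)

  -- The nonnegative difference turns an inequality into an equation, from
  -- which subtraction-free identities finish by the semiring solver.
  ≤⇒∃+ : ∀ {x y} → x ≤ y → ∃ λ z → 0# ≤ z × x + z ≈ y
  ≤⇒∃+ {x} {y} x≤y = y - x , ≤⇒0≤- x≤y , x+[y-x]≈y x y

  *-monoˡ-≤ : ∀ {x y z} → 0# ≤ z → x ≤ y → z * x ≤ z * y
  *-monoˡ-≤ {x} {y} {z} 0≤z x≤y with ≤⇒∃+ x≤y
  ... | d , 0≤d , x+d≈y = begin
    z * x           ≤⟨ x≤x+y (*-nonneg z d 0≤z 0≤d) ⟩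
    z * x + z * d   ≈⟨ distribˡ z x d ⟨
    z * (x + d)     ≈⟨ *-congˡ x+d≈y ⟩
    z * y           ∎

  *-mono-≤ : ∀ {x y u v} → 0# ≤ x → 0# ≤ v → x ≤ y → u ≤ v → x * u ≤ y * v
  *-mono-≤ {x} {y} {u} {v} 0≤x 0≤v x≤y u≤v = begin
    x * u   ≤⟨ *-monoˡ-≤ 0≤x u≤v ⟩
    x * v   ≈⟨ *-comm x v ⟩
    v * x   ≤⟨ *-monoˡ-≤ 0≤v x≤y ⟩
    v * y   ≈⟨ *-comm v y ⟩
    y * v   ∎

  -x*-x≈x*x : ∀ x → - x * - x ≈ x * x
  -x*-x≈x*x x = trans (sym (-‿distribˡ-* x (- x)))
    (trans (-‿cong (sym (-‿distribʳ-* x x))) (-‿involutive (x * x)))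

  ≤0⇒0≤- : ∀ {x} → x ≤ 0# → 0# ≤ - x
  ≤0⇒0≤- {x} x≤0 = ≤-trans (≤⇒0≤- x≤0) (≤-reflexive (+-identityˡ (- x)))

  x*x-nonneg : ∀ x → 0# ≤ x * x
  x*x-nonneg x with total 0# x
  ... | inj₁ 0≤x = *-nonneg x x 0≤x 0≤x
  ... | inj₂ x≤0 = ≤-trans (*-nonneg (- x) (- x) (≤0⇒0≤- x≤0) (≤0⇒0≤- x≤0)) (≤-reflexive (-x*-x≈x*x x))

  0≤1 : 0# ≤ 1#
  0≤1 = ≤-trans (x*x-nonneg 1#) (≤-reflexive (*-identityˡ 1#))

  1≰0 : ¬ 1# ≤ 0#
  1≰0 1≤0 = 0≉1 (antisym 0≤1 1≤0)

  x*x≈0⇒x≈0 : ∀ {x} → x * x ≈ 0# → x ≈ 0#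
  x*x≈0⇒x≈0 {x} x²≈0 with x ≟ 0#
  ... | yes x≈0 = x≈0
  ... | no  x≉0 = begin-equality
    x                ≈⟨ *-identityʳ x ⟨
    x * 1#           ≈⟨ *-congˡ (⁻¹-inverseʳ x x≉0) ⟨
    x * (x * x ⁻¹)   ≈⟨ *-assoc x x (x ⁻¹) ⟨
    x * x * x ⁻¹     ≈⟨ *-congʳ x²≈0 ⟩
    0# * x ⁻¹        ≈⟨ zeroˡ (x ⁻¹) ⟩
    0#               ∎

  2xy≤x²+y² : ∀ x y → x * y + x * y ≤ x * x + y * y
  2xy≤x²+y² x y with total x y
  ... | inj₁ x≤y = let (d , _ , x+d≈y) = ≤⇒∃+ x≤y in begin
    x * y + x * y                     ≈⟨ +-cong (*-congˡ x+d≈y) (*-congˡ x+d≈y) ⟨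
    x * (x + d) + x * (x + d)         ≤⟨ x≤x+y (x*x-nonneg d) ⟩
    x * (x + d) + x * (x + d) + d * d ≈⟨ solve 2 (λ x d → x :* (x :+ d) :+ x :* (x :+ d) :+ d :* d
                                                      := x :* x :+ (x :+ d) :* (x :+ d)) refl x d ⟩
    x * x + (x + d) * (x + d)         ≈⟨ +-congˡ (*-cong x+d≈y x+d≈y) ⟩
    x * x + y * y                     ∎
  ... | inj₂ y≤x = let (d , _ , y+d≈x) = ≤⇒∃+ y≤x in begin
    x * y + x * y                     ≈⟨ +-cong (*-congʳ y+d≈x) (*-congʳ y+d≈x) ⟨
    (y + d) * y + (y + d) * y         ≤⟨ x≤x+y (x*x-nonneg d) ⟩
    (y + d) * y + (y + d) * y + d * d ≈⟨ solve 2 (λ y d → (y :+ d) :* y :+ (y :+ d) :* y :+ d :* d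
                                                      := (y :+ d) :* (y :+ d) :+ y :* y) refl y d ⟩
    (y + d) * (y + d) + y * y         ≈⟨ +-congʳ (*-cong y+d≈x y+d≈x) ⟩
    x * x + y * y                     ∎

  -- If `x` exceeds `y` by `d ≥ 0`, the squares differ by at least `d * d`, which forces `d` to
  -- vanish. The sign of `x` is left open because `x` will be a scalar product.
  square-cancel-≤ : ∀ {x y} → 0# ≤ y → x * x ≤ y * y → x ≤ y
  square-cancel-≤ {x} {y} 0≤y x²≤y² with total x y
  ... | inj₁ x≤y = x≤y
  ... | inj₂ y≤x = let
      (d , 0≤d , y+d≈x) = ≤⇒∃+ y≤x
      d²≤0 : d * d ≤ 0#
      d²≤0 = +-cancelʳ-≤ (y * y) (begin
        d * d + y * y                   ≤⟨ x≤x+y (+-nonneg (*-nonneg y d 0≤y 0≤d) (*-nonneg y d 0≤y 0≤d)) ⟩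
        d * d + y * y + (y * d + y * d) ≈⟨ solve 2 (λ y d → d :* d :+ y :* y :+ (y :* d :+ y :* d)
                                                      := (y :+ d) :* (y :+ d)) refl y d ⟩
        (y + d) * (y + d)               ≈⟨ *-cong y+d≈x y+d≈x ⟩
        x * x                           ≤⟨ x²≤y² ⟩
        y * y                           ≈⟨ +-identityˡ (y * y) ⟨
        0# + y * y                      ∎)
      d≈0 = x*x≈0⇒x≈0 (antisym d²≤0 (x*x-nonneg d))
    in ≤-reflexive (trans (sym y+d≈x) (trans (+-congˡ d≈0) (+-identityʳ y)))

  x*x≤1 : ∀ {x} → x ≤ 1# → - x ≤ 1# → x * x ≤ 1#
  x*x≤1 {x} x≤1 -x≤1 with total 0# x
  ... | inj₁ 0≤x = ≤-trans (*-mono-≤ 0≤x 0≤1 x≤1 x≤1) (≤-reflexive (*-identityˡ 1#))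
  ... | inj₂ x≤0 = ≤-trans (≤-reflexive (sym (-x*-x≈x*x x)))
    (≤-trans (*-mono-≤ (≤0⇒0≤- x≤0) 0≤1 -x≤1 -x≤1) (≤-reflexive (*-identityˡ 1#)))

  √-upper : ∀ {x y} → 0# ≤ x → 0# ≤ y → x ≤ y * y → √ x ≤ y
  √-upper 0≤x 0≤y x≤y² = square-cancel-≤ 0≤y (≤-trans (≤-reflexive (√-square _ 0≤x)) x≤y²)

  √-lower : ∀ {x y} → 0# ≤ x → y * y ≤ x → y ≤ √ x
  √-lower 0≤x y²≤x = square-cancel-≤ (√-nonneg _ 0≤x) (≤-trans y²≤x (≤-reflexive (sym (√-square _ 0≤x))))

  √-mono-≤ : ∀ {x y} → 0# ≤ x → x ≤ y → √ x ≤ √ y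
  √-mono-≤ 0≤x x≤y = √-lower (≤-trans 0≤x x≤y) (≤-trans (≤-reflexive (√-square _ 0≤x)) x≤y)

  -- Naturals and integers among the reals

  fromℕ-nonneg : ∀ n → 0# ≤ fromℕ n
  fromℕ-nonneg zero    = ≤-refl
  fromℕ-nonneg (suc n) = +-nonneg 0≤1 (fromℕ-nonneg n)

  fromℕ-mono-≤ : ∀ {m n} → m ℕ.≤ n → fromℕ m ≤ fromℕ n
  fromℕ-mono-≤ {n = n} ℕ.z≤n = fromℕ-nonneg n
  fromℕ-mono-≤ (ℕ.s≤s m≤n)   = +-mono-≤ ≤-refl (fromℕ-mono-≤ m≤n)

  fromℤ-suc : ∀ a → fromℤ (ℤ.suc a) ≈ fromℤ a + 1#
  fromℤ-suc (+ n)          = +-comm 1# (fromℕ n)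
  fromℤ-suc -[1+ zero ]    = sym (trans (+-congʳ (-‿cong (+-identityʳ 1#))) (-‿inverseˡ 1#))
  fromℤ-suc -[1+ (suc n) ] = begin-equality
    - fromℕ (suc n)                     ≈⟨ +-identityʳ _ ⟨
    - fromℕ (suc n) + 0#                ≈⟨ +-congˡ (-‿inverseˡ 1#) ⟨
    - fromℕ (suc n) + (- 1# + 1#)       ≈⟨ solve 3 (λ a b c → a :+ (b :+ c) := (b :+ a) :+ c) refl _ _ _ ⟩
    - 1# + - fromℕ (suc n) + 1#         ≈⟨ +-congʳ (-‿+-comm 1# (fromℕ (suc n))) ⟩
    - (1# + fromℕ (suc n)) + 1#         ∎

  fromℤ-+ : ∀ a n → fromℤ (a ℤ.+ + n) ≈ fromℤ a + fromℕ n
  fromℤ-+ a zero    = begin-equality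
    fromℤ (a ℤ.+ + 0)   ≡⟨ ≡.cong fromℤ (ℤ.+-identityʳ a) ⟩
    fromℤ a             ≈⟨ +-identityʳ _ ⟨
    fromℤ a + 0#        ∎
  fromℤ-+ a (suc n) = begin-equality
    fromℤ (a ℤ.+ + suc n)        ≡⟨ ≡.cong fromℤ (≡.trans (≡.sym (ℤ.+-assoc a (+ 1) (+ n)))
                                     (≡.cong (λ z → z ℤ.+ + n) (ℤ.+-comm a (+ 1)))) ⟩
    fromℤ (ℤ.suc a ℤ.+ + n)      ≈⟨ fromℤ-+ (ℤ.suc a) n ⟩
    fromℤ (ℤ.suc a) + fromℕ n    ≈⟨ +-congʳ (fromℤ-suc a) ⟩
    fromℤ a + 1# + fromℕ n       ≈⟨ +-assoc _ _ _ ⟩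
    fromℤ a + (1# + fromℕ n)     ∎

  fromℤ-gap : ∀ {a b} n → a ℤ.+ + n ℤ.≤ b → fromℤ a + fromℕ n ≤ fromℤ b
  fromℤ-gap {a} {b} n a+n≤b = begin
    fromℤ a + fromℕ n            ≈⟨ fromℤ-+ a n ⟨
    fromℤ (a ℤ.+ + n)            ≤⟨ x≤x+y (fromℕ-nonneg k) ⟩
    fromℤ (a ℤ.+ + n) + fromℕ k  ≈⟨ fromℤ-+ (a ℤ.+ + n) k ⟨
    fromℤ (a ℤ.+ + n ℤ.+ + k)    ≡⟨ ≡.cong fromℤ a+n+k≡b ⟩
    fromℤ b                      ∎
    where
    k = ℤ.∣ b ℤ.- (a ℤ.+ + n) ∣
    a+n+k≡b : a ℤ.+ + n ℤ.+ + k ≡ b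
    a+n+k≡b = ≡.trans (≡.cong (λ z → (a ℤ.+ + n) ℤ.+ z) (ℤ.0≤i⇒+∣i∣≡i (ℤ.i≤j⇒0≤j-i a+n≤b)))
      (≡.trans (ℤ.+-comm (a ℤ.+ + n) _) (≡.trans (ℤ.+-assoc b _ _)
        (≡.trans (≡.cong (λ z → b ℤ.+ z) (ℤ.+-inverseˡ (a ℤ.+ + n))) (ℤ.+-identityʳ b))))

  -- This carries the outcome of a real comparison of cell corners, all that the program can
  -- observe, back to integer coordinates.
  fromℤ-cancel-≤ : ∀ {a b} → fromℤ a ≤ fromℤ b → a ℤ.≤ b
  fromℤ-cancel-≤ {a} {b} a≤b with a ℤ.≤? b
  ... | yes p = p
  ... | no  p = contradiction (+-cancelʳ-≤ (fromℤ b) (begin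
    1# + fromℤ b          ≈⟨ solve 2 (λ x y → x :+ y := y :+ (x :+ con 0)) refl _ _ ⟩
    fromℤ b + fromℕ 1     ≤⟨ fromℤ-gap {b} 1 (≡.subst (ℤ._≤ a) (ℤ.+-comm (+ 1) b) (ℤ.i<j⇒suc[i]≤j (ℤ.≰⇒> p))) ⟩
    fromℤ a               ≤⟨ a≤b ⟩
    fromℤ b               ≈⟨ +-identityˡ _ ⟨
    0# + fromℤ b          ∎)) 1≰0

  -- The Euclidean distance

  private
    sumSq : Carrier → Carrier → Carrier
    sumSq a b = a * a + b * b

    sumSq-nonneg : ∀ a b → 0# ≤ sumSq a b
    sumSq-nonneg a b = +-nonneg (x*x-nonneg a) (x*x-nonneg b)

    norm : Carrier → Carrier → Carrier
    norm a b = √ (sumSq a b)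

    norm-nonneg : ∀ a b → 0# ≤ norm a b
    norm-nonneg a b = √-nonneg _ (sumSq-nonneg a b)

    -- Lagrange's identity: the difference of the squares of the two sides is the square of
    -- `a * d - b * c`.
    cauchy-schwarz : ∀ a b c d → a * c + b * d ≤ norm a b * norm c d
    cauchy-schwarz a b c d = square-cancel-≤ (*-nonneg _ _ (norm-nonneg a b) (norm-nonneg c d)) (begin
      (a * c + b * d) * (a * c + b * d)
        ≈⟨ solve 4 (λ a b c d → (a :* c :+ b :* d) :* (a :* c :+ b :* d)
             := a :* c :* (a :* c) :+ b :* d :* (b :* d) :+ ((a :* d) :* (b :* c) :+ (a :* d) :* (b :* c)))
             refl a b c d ⟩
      a * c * (a * c) + b * d * (b * d) + ((a * d) * (b * c) + (a * d) * (b * c))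
        ≤⟨ +-mono-≤ ≤-refl (2xy≤x²+y² (a * d) (b * c)) ⟩
      a * c * (a * c) + b * d * (b * d) + ((a * d) * (a * d) + (b * c) * (b * c))
        ≈⟨ solve 4 (λ a b c d → a :* c :* (a :* c) :+ b :* d :* (b :* d)
                                :+ ((a :* d) :* (a :* d) :+ (b :* c) :* (b :* c))
             := (a :* a :+ b :* b) :* (c :* c :+ d :* d)) refl a b c d ⟩
      sumSq a b * sumSq c d
        ≈⟨ *-cong (√-square _ (sumSq-nonneg a b)) (√-square _ (sumSq-nonneg c d)) ⟨
      norm a b * norm a b * (norm c d * norm c d)
        ≈⟨ solve 2 (λ m n → m :* m :* (n :* n) := m :* n :* (m :* n)) refl (norm a b) (norm c d) ⟩
      norm a b * norm c d * (norm a b * norm c d) ∎)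

    norm-triangle : ∀ a b c d → norm (a + c) (b + d) ≤ norm a b + norm c d
    norm-triangle a b c d =
      √-upper (sumSq-nonneg _ _) (+-nonneg (norm-nonneg a b) (norm-nonneg c d)) (begin
      (a + c) * (a + c) + (b + d) * (b + d)
        ≈⟨ solve 4 (λ a b c d → (a :+ c) :* (a :+ c) :+ (b :+ d) :* (b :+ d)
             := (a :* a :+ b :* b) :+ (c :* c :+ d :* d) :+ ((a :* c :+ b :* d) :+ (a :* c :+ b :* d)))
             refl a b c d ⟩
      sumSq a b + sumSq c d + ((a * c + b * d) + (a * c + b * d))
        ≤⟨ +-mono-≤ (≤-reflexive (sym (+-cong (√-square _ (sumSq-nonneg a b)) (√-square _ (sumSq-nonneg c d)))))
                    (+-mono-≤ (cauchy-schwarz a b c d) (cauchy-schwarz a b c d)) ⟩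
      m * m + n * n + (m * n + m * n)
        ≈⟨ solve 2 (λ m n → m :* m :+ n :* n :+ (m :* n :+ m :* n) := (m :+ n) :* (m :+ n)) refl m n ⟩
      (m + n) * (m + n) ∎)
      where
      m = norm a b
      n = norm c d

    norm-cong-≤ : ∀ {a b c d} → a * a ≈ c * c → b * b ≈ d * d → norm a b ≤ norm c d
    norm-cong-≤ {a} {b} a²≈c² b²≈d² = √-mono-≤ (sumSq-nonneg a b) (≤-reflexive (+-cong a²≈c² b²≈d²))

    telescope : ∀ x y z → x - z ≈ (x - y) + (y - z)
    telescope x y z = sym (begin-equality
      (x - y) + (y - z)     ≈⟨ solve 4 (λ x y y′ z → (x :+ y′) :+ (y :+ z) := (x :+ z) :+ (y :+ y′))
                                 refl x y (- y) (- z) ⟩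
      (x - z) + (y - y)     ≈⟨ +-congˡ (-‿inverseʳ y) ⟩
      (x - z) + 0#          ≈⟨ +-identityʳ _ ⟩
      x - z                 ∎)

    flip-square : ∀ x y → (x - y) * (x - y) ≈ (y - x) * (y - x)
    flip-square x y = begin-equality
      (x - y) * (x - y)         ≈⟨ *-cong flip flip ⟩
      - (y - x) * - (y - x)     ≈⟨ -x*-x≈x*x (y - x) ⟩
      (y - x) * (y - x)         ∎
      where
      flip : x - y ≈ - (y - x)
      flip = trans (+-comm x (- y)) (trans (+-congˡ (sym (-‿involutive x))) (-‿+-comm y (- x)))

  dist-nonneg : ∀ P Q → 0# ≤ dist P Q
  dist-nonneg (x , y) (x′ , y′) = norm-nonneg (x - x′) (y - y′)

  dist-sym-≤ : ∀ P Q → dist P Q ≤ dist Q P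
  dist-sym-≤ (x , y) (x′ , y′) = norm-cong-≤ (flip-square x x′) (flip-square y y′)

  dist-triangle : ∀ P Q R → dist P R ≤ dist P Q + dist Q R
  dist-triangle (x , y) (x′ , y′) (x″ , y″) = ≤-trans
    (norm-cong-≤ (*-cong x-eq x-eq) (*-cong y-eq y-eq)) (norm-triangle (x - x′) (y - y′) (x′ - x″) (y′ - y″))
    where
    x-eq = telescope x x′ x″
    y-eq = telescope y y′ y″

  dist-self : ∀ P → dist P P ≤ 0#
  dist-self (x , y) = √-upper (sumSq-nonneg _ _) ≤-refl (≤-reflexive (begin-equality
    (x - x) * (x - x) + (y - y) * (y - y) ≈⟨ +-cong (*-congʳ (-‿inverseʳ x)) (*-congʳ (-‿inverseʳ y)) ⟩
    0# * (x - x) + 0# * (y - y)           ≈⟨ +-cong (zeroˡ _) (zeroˡ _) ⟩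
    0# + 0#                               ≈⟨ +-congˡ (zeroˡ 0#) ⟨
    0# + 0# * 0#                          ≈⟨ +-identityˡ _ ⟩
    0# * 0#                               ∎))

  -- Distances between cells

  private
    gap-square : ∀ {c x x′} → 0# ≤ c → x + c ≤ x′ → c * c ≤ (x - x′) * (x - x′)
    gap-square {c} {x} {x′} 0≤c x+c≤x′ = begin
      c * c                 ≤⟨ *-mono-≤ 0≤c (≤-trans 0≤c c≤) c≤ c≤ ⟩
      (x′ - x) * (x′ - x)   ≈⟨ flip-square x′ x ⟩
      (x - x′) * (x - x′)   ∎
      where
      c≤ : c ≤ x′ - x
      c≤ = +-cancelʳ-≤ x (begin
        c + x           ≈⟨ +-comm c x ⟩
        x + c           ≤⟨ x+c≤x′ ⟩
        x′              ≈⟨ x+[y-x]≈y x x′ ⟨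
        x + (x′ - x)    ≈⟨ +-comm x _ ⟩
        x′ - x + x      ∎)

    -- The cell of the first point takes up one of the `suc k` unit steps itself; the other `k`
    -- separate the points.
    cell-gap : ∀ {a a′ x x′} k → x ≤ fromℤ a + 1# → fromℤ a′ ≤ x′ → a ℤ.+ + suc k ℤ.≤ a′ → x + fromℕ k ≤ x′
    cell-gap {a} {a′} {x} {x′} k x≤a+1 a′≤x′ a+1+k≤a′ = begin
      x + fromℕ k               ≤⟨ +-mono-≤ x≤a+1 ≤-refl ⟩
      fromℤ a + 1# + fromℕ k    ≈⟨ +-assoc _ _ _ ⟩
      fromℤ a + fromℕ (suc k)   ≤⟨ fromℤ-gap {a} (suc k) a+1+k≤a′ ⟩
      fromℤ a′                  ≤⟨ a′≤x′ ⟩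
      x′                        ∎

  dist-column-gap : ∀ {P Q} c c′ k → P InCell c → Q InCell c′ →
                    proj₁ c ℤ.+ + suc k ℤ.≤ proj₁ c′ → fromℕ k ≤ dist P Q
  dist-column-gap {x , y} {x′ , y′} (a , _) _ k ((_ , x≤) , _) ((≤x′ , _) , _) gap = √-lower (sumSq-nonneg _ _)
    (≤-trans (gap-square (fromℕ-nonneg k) (cell-gap {a} k x≤ ≤x′ gap)) (x≤x+y (x*x-nonneg (y - y′))))

  dist-row-gap : ∀ {P Q} c c′ k → P InCell c → Q InCell c′ →
                 proj₂ c ℤ.+ + suc k ℤ.≤ proj₂ c′ → fromℕ k ≤ dist P Q
  dist-row-gap {x , y} {x′ , y′} (_ , b) _ k (_ , (_ , y≤)) (_ , (≤y′ , _)) gap = √-lower (sumSq-nonneg _ _)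
    (≤-trans (gap-square (fromℕ-nonneg k) (cell-gap {b} k y≤ ≤y′ gap)) (x≤y+x (x*x-nonneg (x - x′))))

  private
    side-square : ∀ {a x x′} → a ≤ x × x ≤ a + 1# → a ≤ x′ × x′ ≤ a + 1# → (x - x′) * (x - x′) ≤ 1#
    side-square {a} {x} {x′} (a≤x , x≤a+1) (a≤x′ , x′≤a+1) =
      x*x≤1 (bound a≤x′ x≤a+1) (≤-trans (≤-reflexive -[x-x′]≈) (bound a≤x x′≤a+1))
      where
      -[x-x′]≈ : - (x - x′) ≈ x′ - x
      -[x-x′]≈ = trans (sym (-‿+-comm x (- x′))) (trans (+-congˡ (-‿involutive x′)) (+-comm (- x) x′))
      bound : ∀ {x x′} → a ≤ x′ → x ≤ a + 1# → x - x′ ≤ 1#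
      bound {x} {x′} a≤x′ x≤a+1 = +-cancelʳ-≤ x′ (begin
        x - x′ + x′     ≈⟨ +-comm _ x′ ⟩
        x′ + (x - x′)   ≈⟨ x+[y-x]≈y x′ x ⟩
        x               ≤⟨ x≤a+1 ⟩
        a + 1#          ≤⟨ +-mono-≤ a≤x′ ≤-refl ⟩
        x′ + 1#         ≈⟨ +-comm x′ 1# ⟩
        1# + x′         ∎)

  dist-same-cell : ∀ {P Q c} → P InCell c → Q InCell c → dist P Q ≤ √ 2#
  dist-same-cell {x , y} {x′ , y′} (inA , inB) (inA′ , inB′) = √-mono-≤ (sumSq-nonneg _ _) (begin
    sumSq (x - x′) (y - y′)   ≤⟨ +-mono-≤ (side-square inA inA′) (side-square inB inB′) ⟩
    1# + 1#                   ≈⟨ +-congˡ (+-identityʳ 1#) ⟨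
    2#                        ∎)

  private
    h : Carrier
    h = 2# ⁻¹

    h+h≈1 : h + h ≈ 1#
    h+h≈1 = begin-equality
      -- `2#` unfolds to `1# + (1# + 0#)`, hence the shape of the constant given to the solver.
      h + h       ≈⟨ solve 1 (λ h → h :+ h := (con 1 :+ (con 1 :+ con 0)) :* h) refl h ⟩
      2# * h      ≈⟨ ⁻¹-inverseʳ 2# (λ 2≈0 → 1≰0 (≤-trans (x≤x+y (fromℕ-nonneg 1)) (≤-reflexive 2≈0))) ⟩
      1#          ∎

    0≤h : 0# ≤ h
    0≤h with total 0# h
    ... | inj₁ 0≤h = 0≤h
    ... | inj₂ h≤0 = contradiction (begin
      1#          ≈⟨ h+h≈1 ⟨
      h + h       ≤⟨ +-mono-≤ h≤0 h≤0 ⟩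
      0# + 0#     ≈⟨ +-identityˡ 0# ⟩
      0#          ∎) 1≰0

  1≤√2 : 1# ≤ √ 2#
  1≤√2 = √-lower (fromℕ-nonneg 2) (≤-trans (≤-reflexive (*-identityˡ 1#)) (x≤x+y (fromℕ-nonneg 1)))

  -- Write 2 as 3/2 + 1/2 and replace the last half by an eighth copy of √2.
  ratio-≤ : ∀ {ε} → 0# ≤ ε → 2# + fromℕ 7 * √ 2# ≤ (fromℕ 3 * fromℕ 2 ⁻¹ + fromℕ 8 * √ (fromℕ 2)) + ε
  ratio-≤ {ε} 0≤ε = begin
    2# + fromℕ 7 * √ 2#                             ≈⟨ +-congʳ (+-cong h+h≈1 (+-congʳ h+h≈1)) ⟨
    (h + h + (h + h + 0#)) + fromℕ 7 * √ 2#
      ≈⟨ solve 3 (λ h k s → (h :+ h :+ (h :+ h :+ con 0)) :+ k :* s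
           := (con 1 :+ (con 1 :+ (con 1 :+ con 0))) :* h :+ (h :+ k :* s)) refl h (fromℕ 7) (√ 2#) ⟩
    fromℕ 3 * h + (h + fromℕ 7 * √ 2#)              ≤⟨ +-mono-≤ ≤-refl (+-mono-≤ h≤√2 ≤-refl) ⟩
    fromℕ 3 * h + (√ 2# + fromℕ 7 * √ 2#)           ≈⟨ +-congˡ (solve 2 (λ k s → s :+ k :* s := (con 1 :+ k) :* s) refl (fromℕ 7) (√ 2#)) ⟩
    fromℕ 3 * h + fromℕ 8 * √ 2#                    ≤⟨ x≤x+y 0≤ε ⟩
    (fromℕ 3 * h + fromℕ 8 * √ 2#) + ε              ∎
    where
    h≤√2 : h ≤ √ 2#
    h≤√2 = ≤-trans (x≤x+y 0≤h) (≤-trans (≤-reflexive h+h≈1) 1≤√2)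

  module OnInstance (I : Instance) where
    open Instance I
    open Semantics I

    -- Paths and the weight of a cycle

    path : Fin n → List (Fin n) → Carrier
    path v []       = 0#
    path v (u ∷ us) = weight v u + path u us

    -- The recursion behind cyclicWeight is private to its module; it is reached
    -- by unification, as the function c with the three equations below.
    private
      closed-path : (c : Fin n → Fin n → List (Fin n) → Carrier) →
        (∀ s v us → cyclicWeight I (s ∷ v ∷ us) ≡ weight s v + c s v us) →
        (∀ s v → c s v [] ≡ weight v s) → (∀ s v u us → c s v (u ∷ us) ≡ weight v u + c s u us) →
        ∀ v us → cyclicWeight I (v ∷ us) ≈ path v (us ++ [ v ])
      closed-path c eq₁ eq₂ eq₃ v []       = sym (+-identityʳ _)
      closed-path c eq₁ eq₂ eq₃ v (u ∷ us) = begin-equality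
        cyclicWeight I (v ∷ u ∷ us)     ≡⟨ eq₁ v u us ⟩
        weight v u + c v u us           ≈⟨ +-congˡ (go u us) ⟩
        path v (u ∷ us ++ [ v ])        ∎
        where
        go : ∀ u us → c v u us ≈ path u (us ++ [ v ])
        go u []        = begin-equality
          c v u []          ≡⟨ eq₂ v u ⟩
          weight u v        ≈⟨ +-identityʳ _ ⟨
          path u [ v ]      ∎
        go u (u′ ∷ us) = begin-equality
          c v u (u′ ∷ us)           ≡⟨ eq₃ v u u′ us ⟩
          weight u u′ + c v u′ us   ≈⟨ +-congˡ (go u′ us) ⟩
          path u (u′ ∷ us ++ [ v ]) ∎

    cyclicWeight≈path : ∀ v us → cyclicWeight I (v ∷ us) ≈ path v (us ++ [ v ])
    cyclicWeight≈path = closed-path _ (λ _ _ _ → ≡.refl) (λ _ _ → ≡.refl) (λ _ _ _ _ → ≡.refl)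

    weight-nonneg : ∀ u v → 0# ≤ weight u v
    weight-nonneg u v = dist-nonneg (point u) (point v)

    weight-sym-≤ : ∀ u v → weight u v ≤ weight v u
    weight-sym-≤ u v = dist-sym-≤ (point u) (point v)

    weight-triangle : ∀ u v x → weight u x ≤ weight u v + weight v x
    weight-triangle u v x = dist-triangle (point u) (point v) (point x)

    path-nonneg : ∀ v us → 0# ≤ path v us
    path-nonneg v []       = ≤-refl
    path-nonneg v (u ∷ us) = +-nonneg (weight-nonneg v u) (path-nonneg u us)

    path-detour : ∀ u v us → path u us ≤ weight u v + path v us
    path-detour u v []       = +-nonneg (weight-nonneg u v) ≤-refl
    path-detour u v (x ∷ us) = begin
      weight u x + path x us                  ≤⟨ +-mono-≤ (weight-triangle u v x) ≤-refl ⟩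
      weight u v + weight v x + path x us     ≈⟨ +-assoc _ _ _ ⟩
      weight u v + (weight v x + path x us)   ∎

    -- Shortcutting: the triangle inequality bypasses every omitted vertex.
    path-sublist : ∀ v {us vs} → us ⊆ vs → path v us ≤ path v vs
    path-sublist v []                = ≤-refl
    path-sublist v {us} (u ∷ʳ us⊆vs) = ≤-trans (path-detour v u us) (+-mono-≤ ≤-refl (path-sublist u us⊆vs))
    path-sublist v (≡.refl ∷ us⊆vs)  = +-mono-≤ ≤-refl (path-sublist _ us⊆vs)

    path-skip : ∀ v us x vs → weight v x + path x vs ≤ path v (us ++ x ∷ vs)
    path-skip v []       x vs = ≤-refl
    path-skip v (u ∷ us) x vs = begin
      weight v x + path x vs                  ≤⟨ +-mono-≤ (weight-triangle v u x) ≤-refl ⟩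
      weight v u + weight u x + path x vs     ≈⟨ +-assoc _ _ _ ⟩
      weight v u + (weight u x + path x vs)   ≤⟨ +-mono-≤ ≤-refl (path-skip u us x vs) ⟩
      path v (u ∷ us ++ x ∷ vs)               ∎

    private
      path-from : ∀ v {us x} → x ∈ us → weight v x ≤ path v us
      path-from v x∈us with ∈-∃++ x∈us
      ... | as , bs , ≡.refl = ≤-trans (x≤x+y (path-nonneg _ bs)) (path-skip v as _ bs)

    weight≤path : ∀ {v us x y} → x ∈ v ∷ us → y ∈ v ∷ us → weight x y ≤ path v us
    weight≤path {v} {us} (here ≡.refl) (here ≡.refl) = ≤-trans (dist-self (point v)) (path-nonneg v us)
    weight≤path {v} (here ≡.refl) (there y∈us)  = path-from v y∈us
    weight≤path {v} (there x∈us)  (here ≡.refl) = ≤-trans (weight-sym-≤ _ v) (path-from v x∈us)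
    weight≤path {v} {u ∷ us} (there x∈us) (there y∈us) = ≤-trans (weight≤path {u} {us} x∈us y∈us) (x≤y+x (weight-nonneg v u))

    private
      -- From `v` one can return to `u` and continue to `x`, so the detour costs at most the new
      -- edge twice.
      insert-after : ∀ u v x xs → path u (v ∷ x ∷ xs) ≤ path u (x ∷ xs) + (weight u v + weight u v)
      insert-after u v x xs = begin
        weight u v + (weight v x + path x xs)
          ≤⟨ +-mono-≤ ≤-refl (+-mono-≤ (weight-triangle v u x) ≤-refl) ⟩
        weight u v + (weight v u + weight u x + path x xs)
          ≤⟨ +-mono-≤ ≤-refl (+-mono-≤ (+-mono-≤ (weight-sym-≤ v u) ≤-refl) ≤-refl) ⟩
        weight u v + (weight u v + weight u x + path x xs)
          ≈⟨ solve 3 (λ a b c → a :+ (a :+ b :+ c) := b :+ c :+ (a :+ a)) refl _ _ _ ⟩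
        path u (x ∷ xs) + (weight u v + weight u v) ∎

      insert-path : ∀ s us u v x xs →
        path s (us ++ u ∷ v ∷ x ∷ xs) ≤ path s (us ++ u ∷ x ∷ xs) + (weight u v + weight u v)
      insert-path s []        u v x xs =
        ≤-trans (+-mono-≤ ≤-refl (insert-after u v x xs)) (≤-reflexive (sym (+-assoc _ _ _)))
      insert-path s (s′ ∷ us) u v x xs =
        ≤-trans (+-mono-≤ ≤-refl (insert-path s′ us u v x xs)) (≤-reflexive (sym (+-assoc _ _ _)))

      -- Insertion needs a successor of `u`. In the closed path there always is one, namely the
      -- start if `u` comes last.
      snoc-cons : ∀ (ys : List (Fin n)) s → ∃ λ x → ∃ λ xs → ys ++ [ s ] ≡ x ∷ xs
      snoc-cons []       s = s , [] , ≡.refl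
      snoc-cons (y ∷ ys) s = y , ys ++ [ s ] , ≡.refl

    cyclicWeight-insert : ∀ xs u v ys →
      cyclicWeight I (xs ++ u ∷ v ∷ ys) ≤ cyclicWeight I (xs ++ u ∷ ys) + (weight u v + weight u v)
    cyclicWeight-insert [] u v ys with snoc-cons ys u
    ... | x , xs , eq = begin
      cyclicWeight I (u ∷ v ∷ ys)                                 ≈⟨ cyclicWeight≈path u (v ∷ ys) ⟩
      path u (v ∷ ys ++ [ u ])                                    ≡⟨ ≡.cong (λ l → path u (v ∷ l)) eq ⟩
      path u (v ∷ x ∷ xs)                                         ≤⟨ insert-after u v x xs ⟩
      path u (x ∷ xs) + (weight u v + weight u v)                 ≡⟨ ≡.cong (λ l → path u l + _) eq ⟨
      path u (ys ++ [ u ]) + (weight u v + weight u v)            ≈⟨ +-congʳ (cyclicWeight≈path u ys) ⟨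
      cyclicWeight I (u ∷ ys) + (weight u v + weight u v)         ∎
    cyclicWeight-insert (s ∷ us) u v ys with snoc-cons ys s
    ... | x , xs , eq = begin
      cyclicWeight I (s ∷ us ++ u ∷ v ∷ ys)                       ≈⟨ cyclicWeight≈path s (us ++ u ∷ v ∷ ys) ⟩
      path s ((us ++ u ∷ v ∷ ys) ++ [ s ])                        ≡⟨ ≡.cong (path s) (List.++-assoc us _ _) ⟩
      path s (us ++ u ∷ v ∷ (ys ++ [ s ]))                        ≡⟨ ≡.cong (λ l → path s (us ++ u ∷ v ∷ l)) eq ⟩
      path s (us ++ u ∷ v ∷ x ∷ xs)                               ≤⟨ insert-path s us u v x xs ⟩
      path s (us ++ u ∷ x ∷ xs) + (weight u v + weight u v)       ≡⟨ ≡.cong (λ l → path s (us ++ u ∷ l) + _) eq ⟨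
      path s (us ++ u ∷ (ys ++ [ s ])) + (weight u v + weight u v) ≡⟨ ≡.cong (λ l → path s l + _) (List.++-assoc us _ _) ⟨
      path s ((us ++ u ∷ ys) ++ [ s ]) + (weight u v + weight u v) ≈⟨ +-congʳ (cyclicWeight≈path s (us ++ u ∷ ys)) ⟨
      cyclicWeight I (s ∷ us ++ u ∷ ys) + (weight u v + weight u v) ∎

    -- Eight distinct cells on a path

    private
      col row : Fin n → ℤ
      col v = proj₁ (cell v)
      row v = proj₂ (cell v)

      pathOf : List (Fin n) → Carrier
      pathOf []       = 0#
      pathOf (v ∷ vs) = path v vs

      pathOf-sublist : ∀ {us vs} → us ⊆ vs → pathOf us ≤ pathOf vs
      pathOf-sublist []                   = ≤-refl
      pathOf-sublist (≡.refl ∷ us⊆vs)     = path-sublist _ us⊆vs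
      pathOf-sublist {us} {v ∷ vs} (.v ∷ʳ us⊆vs) = ≤-trans (pathOf-sublist us⊆vs) (drop-head vs)
        where
        drop-head : ∀ vs → pathOf vs ≤ path v vs
        drop-head []       = ≤-refl
        drop-head (u ∷ vs) = x≤y+x (weight-nonneg v u)

      module Window (v : Fin n) (vs : List (Fin n)) (vs! : Unique (map cell (v ∷ vs)))
                    (8≤ : 8 ℕ.≤ length (v ∷ vs)) where

        open Extrema ℤ.≤-totalOrder using (argmin; argmin-sel; f[argmin]≤f[⊤]; f[argmin]≤f[xs])

        least : (f : Fin n → ℤ) → ∃ λ u → u ∈ v ∷ vs × (∀ {z} → z ∈ v ∷ vs → f u ℤ.≤ f z)
        least f = argmin f v vs , member (argmin-sel f v vs) , bound
          where
          member : argmin f v vs ≡ v ⊎ argmin f v vs ∈ vs → argmin f v vs ∈ v ∷ vs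
          member (inj₁ eq) = here eq
          member (inj₂ m)  = there m
          bound : ∀ {z} → z ∈ v ∷ vs → f (argmin f v vs) ℤ.≤ f z
          bound (here ≡.refl) = f[argmin]≤f[⊤] {f = f} v vs
          bound (there z∈vs)  = All.lookup (f[argmin]≤f[xs] {f = f} v vs) z∈vs

        -- The least column and the least row: unless some cell lies three columns or rows further
        -- on, all cells lie in the 3×3 square with this lower left corner.
        α β : ℤ
        α = col (proj₁ (least col))
        β = row (proj₁ (least row))

        Middle : Fin n → Set
        Middle u = col u ≡ α ℤ.+ + 1 ⊎ row u ≡ β ℤ.+ + 1

        middle? : ∀ u → Dec (Middle u)
        middle? u = (col u ℤ.≟ α ℤ.+ + 1) ⊎-dec (row u ℤ.≟ β ℤ.+ + 1)

        -- The 3×3 square without its corners. As it has five cells, at least three of the eight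
        -- cells are corners of the square.
        cross : List Cell
        cross = (α , β ℤ.+ + 1) ∷ (α ℤ.+ + 2 , β ℤ.+ + 1) ∷ (α ℤ.+ + 1 , β) ∷
                (α ℤ.+ + 1 , β ℤ.+ + 1) ∷ (α ℤ.+ + 1 , β ℤ.+ + 2) ∷ []

        Within : ℤ → ℤ → Set
        Within γ c = c ≡ γ ⊎ c ≡ γ ℤ.+ + 1 ⊎ c ≡ γ ℤ.+ + 2

        middle-∈-cross : ∀ {u} → Within α (col u) → Within β (row u) → Middle u → cell u ∈ cross
        middle-∈-cross (inj₁ p) _ (inj₂ q) = here (≡.cong₂ _,_ p q)
        middle-∈-cross (inj₂ (inj₂ p)) _ (inj₂ q) = there (here (≡.cong₂ _,_ p q))
        middle-∈-cross (inj₂ (inj₁ p)) _ (inj₂ q) = there (there (there (here (≡.cong₂ _,_ p q))))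
        middle-∈-cross _ (inj₁ q) (inj₁ p) = there (there (here (≡.cong₂ _,_ p q)))
        middle-∈-cross _ (inj₂ (inj₁ q)) (inj₁ p) = there (there (there (here (≡.cong₂ _,_ p q))))
        middle-∈-cross _ (inj₂ (inj₂ q)) (inj₁ p) = there (there (there (there (here (≡.cong₂ _,_ p q)))))

        Extreme : ℤ → ℤ → Set
        Extreme γ c = c ≡ γ ⊎ c ≡ γ ℤ.+ + 2

        extreme : ∀ {γ c} → Within γ c → c ≢ γ ℤ.+ + 1 → Extreme γ c
        extreme (inj₁ p)        _ = inj₁ p
        extreme (inj₂ (inj₁ p)) q = contradiction p q
        extreme (inj₂ (inj₂ p)) _ = inj₂ p

        Corner : Fin n → Set
        Corner u = Extreme α (col u) × Extreme β (row u)

        col-gap : ∀ {u u′ γ} → col u ≡ γ → col u′ ≡ γ ℤ.+ + 2 → 1# ≤ weight u u′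
        col-gap {u} {u′} ≡.refl eq = ≤-trans (≤-reflexive (sym (+-identityʳ 1#)))
          (dist-column-gap (cell u) (cell u′) 1 (inCell u) (inCell u′) (ℤ.≤-reflexive (≡.sym eq)))

        row-gap : ∀ {u u′ γ} → row u ≡ γ → row u′ ≡ γ ℤ.+ + 2 → 1# ≤ weight u u′
        row-gap {u} {u′} ≡.refl eq = ≤-trans (≤-reflexive (sym (+-identityʳ 1#)))
          (dist-row-gap (cell u) (cell u′) 1 (inCell u) (inCell u′) (ℤ.≤-reflexive (≡.sym eq)))

        -- Distinct corners differ by two in the column or in the row, so the width of a whole cell
        -- separates their points.
        corners-apart : ∀ {u u′} → Corner u → Corner u′ → cell u ≢ cell u′ → 1# ≤ weight u u′
        corners-apart (inj₁ p , _) (inj₂ p′ , _) _ = col-gap p p′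
        corners-apart {u} {u′} (inj₂ p , _) (inj₁ p′ , _) _ = ≤-trans (col-gap p′ p) (weight-sym-≤ u′ u)
        corners-apart (_ , inj₁ q) (_ , inj₂ q′) _ = row-gap q q′
        corners-apart {u} {u′} (_ , inj₂ q) (_ , inj₁ q′) _ = ≤-trans (row-gap q′ q) (weight-sym-≤ u′ u)
        corners-apart (inj₁ p , inj₁ q) (inj₁ p′ , inj₁ q′) ≢ =
          contradiction (≡.cong₂ _,_ (≡.trans p (≡.sym p′)) (≡.trans q (≡.sym q′))) ≢
        corners-apart (inj₁ p , inj₂ q) (inj₁ p′ , inj₂ q′) ≢ =
          contradiction (≡.cong₂ _,_ (≡.trans p (≡.sym p′)) (≡.trans q (≡.sym q′))) ≢
        corners-apart (inj₂ p , inj₁ q) (inj₂ p′ , inj₁ q′) ≢ =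
          contradiction (≡.cong₂ _,_ (≡.trans p (≡.sym p′)) (≡.trans q (≡.sym q′))) ≢
        corners-apart (inj₂ p , inj₂ q) (inj₂ p′ , inj₂ q′) ≢ =
          contradiction (≡.cong₂ _,_ (≡.trans p (≡.sym p′)) (≡.trans q (≡.sym q′))) ≢

        three-corners : ∀ us → 3 ℕ.≤ length us → All Corner us → Unique (map cell us) → 2# ≤ pathOf us
        three-corners (x ∷ y ∷ z ∷ us) _ (cx ∷ cy ∷ cz ∷ _) ((x≢y ∷ _) ∷ (y≢z ∷ _) ∷ _) =
          +-mono-≤ (corners-apart cx cy x≢y) (≤-trans (≤-reflexive (+-identityʳ 1#))
            (≤-trans (corners-apart cy cz y≢z) (x≤x+y (path-nonneg z us))))
        three-corners (_ ∷ []) (ℕ.s≤s ())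
        three-corners (_ ∷ _ ∷ []) (ℕ.s≤s (ℕ.s≤s ()))

        box-bound : (∀ {u} → u ∈ v ∷ vs → Within α (col u)) → (∀ {u} → u ∈ v ∷ vs → Within β (row u)) →
                    2# ≤ path v vs
        box-bound in-col in-row = ≤-trans
          (three-corners corners 3≤corners
            (All.tabulate λ u∈ → let (u∈vs , ¬mid) = ∈-filter⁻ (¬? ∘ middle?) {xs = v ∷ vs} u∈ in
              extreme (in-col u∈vs) (¬mid ∘ inj₁) , extreme (in-row u∈vs) (¬mid ∘ inj₂))
            (unique-sublist (filter-⊆ (¬? ∘ middle?) (v ∷ vs)) vs!))
          (pathOf-sublist (filter-⊆ (¬? ∘ middle?) (v ∷ vs)))
          where
          corners = filter (¬? ∘ middle?) (v ∷ vs)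
          middles = filter middle? (v ∷ vs)
          unique-sublist : ∀ {us ws : List (Fin n)} → us ⊆ ws → Unique (map cell ws) → Unique (map cell us)
          unique-sublist [] _ = []
          unique-sublist (_ ∷ʳ us⊆ws) (_ ∷ ws!) = unique-sublist us⊆ws ws!
          unique-sublist (≡.refl ∷ us⊆ws) (w∉ ∷ ws!) =
            All.tabulate (λ c∈ → let (u , u∈us , eq) = ∈-map⁻ cell c∈ in
              λ eq′ → All.lookup w∉ (∈-map⁺ cell (Sublist.lookup us⊆ws u∈us))
                (≡.trans eq′ eq)) ∷ unique-sublist us⊆ws ws!
          middles≤5 : length middles ℕ.≤ 5
          middles≤5 = ≡.subst (ℕ._≤ 5) (List.length-map cell middles)
            (unique-⊆⇒length-≤ (unique-sublist (filter-⊆ middle? (v ∷ vs)) vs!)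
              λ c∈ → let (u , u∈ , eq) = ∈-map⁻ cell c∈
                         (u∈vs , mid) = ∈-filter⁻ middle? {xs = v ∷ vs} u∈
                     in ≡.subst (_∈ cross) (≡.sym eq) (middle-∈-cross (in-col u∈vs) (in-row u∈vs) mid))
          3≤corners : 3 ℕ.≤ length corners
          3≤corners = ℕ.+-cancelˡ-≤ 5 3 (length corners) (ℕ.≤-trans 8≤
            (ℕ.≤-trans (ℕ.≤-reflexive (≡.sym (length-filter-¬ middle? (v ∷ vs)))) (ℕ.+-monoˡ-≤ (length corners) middles≤5)))

        window-bound : 2# ≤ path v vs
        -- Deciding the bound first makes a cell three columns or rows away contradictory, and only
        -- the 3×3 square remains.
        window-bound with 2# ≤? path v vs
        ... | yes p = p
        ... | no  p = box-bound
          (λ {u} u∈ → let (a , a∈ , a≤) = least col in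
            within-two (a≤ u∈) λ far → p (≤-trans (dist-column-gap (cell a) (cell u) 2 (inCell a) (inCell u) far) (weight≤path {v} {vs} a∈ u∈)))
          (λ {u} u∈ → let (b , b∈ , b≤) = least row in
            within-two (b≤ u∈) λ far → p (≤-trans (dist-row-gap (cell b) (cell u) 2 (inCell b) (inCell u) far) (weight≤path {v} {vs} b∈ u∈)))

    eight-cells : ∀ v vs → Unique (map cell (v ∷ vs)) → 8 ℕ.≤ length (v ∷ vs) → 2# ≤ path v vs
    eight-cells v vs vs! 8≤ = Window.window-bound v vs vs! 8≤

    -- Averaging over the windows of a cycle

    private
      rotate : List (Fin n) → List (Fin n)
      rotate []       = []
      rotate (v ∷ vs) = vs ++ [ v ]

      rotateBy : ℕ → List (Fin n) → List (Fin n)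
      rotateBy zero    vs = vs
      rotateBy (suc k) vs = rotateBy k (rotate vs)

      first-edge : List (Fin n) → Carrier
      first-edge []           = 0#
      first-edge (v ∷ [])     = weight v v
      first-edge (v ∷ u ∷ us) = weight v u

      -- The weight of the first k edges of the walk going round the cycle for ever.
      walk : ℕ → List (Fin n) → Carrier
      walk zero    vs = 0#
      walk (suc k) vs = first-edge vs + walk k (rotate vs)

      walk-+ : ∀ k l vs → walk (k ℕ.+ l) vs ≈ walk k vs + walk l (rotateBy k vs)
      walk-+ zero    l vs = sym (+-identityˡ _)
      walk-+ (suc k) l vs = trans (+-congˡ (walk-+ k l (rotate vs))) (sym (+-assoc _ _ _))

      rotateBy-length : ∀ us vs → rotateBy (length us) (us ++ vs) ≡ vs ++ us
      rotateBy-length []       vs = ≡.sym (List.++-identityʳ vs)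
      rotateBy-length (u ∷ us) vs = ≡.trans (≡.cong (rotateBy (length us)) (List.++-assoc us vs [ u ]))
        (≡.trans (rotateBy-length us (vs ++ [ u ])) (List.++-assoc vs [ u ] us))

      rotateBy-↭ : ∀ k vs → rotateBy k vs ↭ vs
      rotateBy-↭ zero    vs       = _↭_.refl
      rotateBy-↭ (suc k) []       = rotateBy-↭ k []
      rotateBy-↭ (suc k) (v ∷ vs) = ↭-trans (rotateBy-↭ k (vs ++ [ v ])) (++-comm vs [ v ])

      -- The arbitrary tail `vs` absorbs the vertices that rotation moves to the end; without it the
      -- induction would not go through.
      walk-path : ∀ v us x vs → walk (suc (length us)) (v ∷ us ++ x ∷ vs) ≈ path v (us ++ [ x ])
      walk-path v []       x vs = refl
      walk-path v (u ∷ us) x vs = +-congˡ (begin-equality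
        walk (suc (length us)) ((u ∷ us ++ x ∷ vs) ++ [ v ])  ≡⟨ ≡.cong (λ l → walk (suc (length us)) (u ∷ l)) (List.++-assoc us (x ∷ vs) [ v ]) ⟩
        walk (suc (length us)) (u ∷ us ++ x ∷ (vs ++ [ v ]))  ≈⟨ walk-path u us x (vs ++ [ v ]) ⟩
        path u (us ++ [ x ])                                  ∎)

      walk-round : ∀ v vs → walk (length (v ∷ vs)) (v ∷ vs) ≈ cyclicWeight I (v ∷ vs)
      walk-round v []       = +-identityʳ _
      walk-round v (u ∷ us) = trans (+-congˡ (walk-path u us v [])) (sym (cyclicWeight≈path v (u ∷ us)))

      walk-rounds : ∀ k v vs → walk (k ℕ.* length (v ∷ vs)) (v ∷ vs) ≈ fromℕ k * cyclicWeight I (v ∷ vs)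
      walk-rounds zero    v vs = sym (zeroˡ _)
      walk-rounds (suc k) v vs = begin-equality
        walk (N ℕ.+ k ℕ.* N) (v ∷ vs)                               ≈⟨ walk-+ N (k ℕ.* N) (v ∷ vs) ⟩
        walk N (v ∷ vs) + walk (k ℕ.* N) (rotateBy N (v ∷ vs))      ≡⟨ ≡.cong (λ l → walk N (v ∷ vs) + walk (k ℕ.* N) l) round ⟩
        walk N (v ∷ vs) + walk (k ℕ.* N) (v ∷ vs)                   ≈⟨ +-cong (walk-round v vs) (walk-rounds k v vs) ⟩
        L + fromℕ k * L                                             ≈⟨ solve 2 (λ l k → l :+ k :* l := (con 1 :+ k) :* l) refl L (fromℕ k) ⟩
        fromℕ (suc k) * L                                           ∎
        where
        N = length (v ∷ vs)
        L = cyclicWeight I (v ∷ vs)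
        round : rotateBy N (v ∷ vs) ≡ v ∷ vs
        round = ≡.trans (≡.cong (rotateBy N) (≡.sym (List.++-identityʳ (v ∷ vs)))) (rotateBy-length (v ∷ vs) [])

      unique-↭ : ∀ {us vs} → us ↭ vs → Unique (map cell vs) → Unique (map cell us)
      unique-↭ us↭vs vs! = Permutation.Unique-resp-↭ (≡.setoid Cell) (↭⇒↭ₛ (map⁺ cell (↭-sym us↭vs))) vs!

      -- With at least eight vertices, seven edges do not wrap around, so their eight endpoints lie
      -- in distinct cells.
      walk-seven : ∀ vs → Unique (map cell vs) → 8 ℕ.≤ length vs → 2# ≤ walk 7 vs
      walk-seven (a ∷ b ∷ c ∷ d ∷ e ∷ f ∷ g ∷ h ∷ vs) vs! _ = eight-cells a (b ∷ c ∷ d ∷ e ∷ f ∷ g ∷ h ∷ [])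
        (≡.subst Unique (take-map (a ∷ b ∷ c ∷ d ∷ e ∷ f ∷ g ∷ h ∷ vs)) (Unique.take⁺ 8 vs!)) ℕ.≤-refl
        where
        take-map : ∀ us → take 8 (map cell us) ≡ map cell (take 8 us)
        take-map us = List.take-map 8 us
      walk-seven (_ ∷ []) _ (ℕ.s≤s ())
      walk-seven (_ ∷ _ ∷ []) _ (ℕ.s≤s (ℕ.s≤s ()))
      walk-seven (_ ∷ _ ∷ _ ∷ []) _ (ℕ.s≤s (ℕ.s≤s (ℕ.s≤s ())))
      walk-seven (_ ∷ _ ∷ _ ∷ _ ∷ []) _ (ℕ.s≤s (ℕ.s≤s (ℕ.s≤s (ℕ.s≤s ()))))
      walk-seven (_ ∷ _ ∷ _ ∷ _ ∷ _ ∷ []) _ (ℕ.s≤s (ℕ.s≤s (ℕ.s≤s (ℕ.s≤s (ℕ.s≤s ())))))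
      walk-seven (_ ∷ _ ∷ _ ∷ _ ∷ _ ∷ _ ∷ []) _ (ℕ.s≤s (ℕ.s≤s (ℕ.s≤s (ℕ.s≤s (ℕ.s≤s (ℕ.s≤s ()))))))
      walk-seven (_ ∷ _ ∷ _ ∷ _ ∷ _ ∷ _ ∷ _ ∷ []) _ (ℕ.s≤s (ℕ.s≤s (ℕ.s≤s (ℕ.s≤s (ℕ.s≤s (ℕ.s≤s (ℕ.s≤s ())))))))

      walk-sevens : ∀ k vs → Unique (map cell vs) → 8 ℕ.≤ length vs → fromℕ k * 2# ≤ walk (k ℕ.* 7) vs
      walk-sevens zero    vs _   _  = ≤-reflexive (zeroˡ _)
      walk-sevens (suc k) vs vs! 8≤ = begin
        (1# + fromℕ k) * 2#                             ≈⟨ distribʳ _ _ _ ⟩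
        1# * 2# + fromℕ k * 2#                          ≈⟨ +-congʳ (*-identityˡ _) ⟩
        2# + fromℕ k * 2#
          ≤⟨ +-mono-≤ (walk-seven vs vs! 8≤) (walk-sevens k (rotateBy 7 vs)
               (unique-↭ (rotateBy-↭ 7 vs) vs!) (ℕ.≤-trans 8≤ (ℕ.≤-reflexive (≡.sym (↭-length (rotateBy-↭ 7 vs)))))) ⟩
        walk 7 vs + walk (k ℕ.* 7) (rotateBy 7 vs)      ≈⟨ walk-+ 7 (k ℕ.* 7) vs ⟨
        walk (suc k ℕ.* 7) vs                           ∎

    -- One walk of 7N edges is read in two ways: as N windows of seven edges laid end to end, each
    -- of weight at least 2, and as seven rounds of the cycle.
    cycle-lower-bound : ∀ vs → Unique (map cell vs) → 8 ℕ.≤ length vs →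
                        fromℕ (length vs) * 2# ≤ fromℕ 7 * cyclicWeight I vs
    cycle-lower-bound (v ∷ vs) vs! 8≤ = begin
      fromℕ N * 2#                      ≤⟨ walk-sevens N (v ∷ vs) vs! 8≤ ⟩
      walk (N ℕ.* 7) (v ∷ vs)           ≡⟨ ≡.cong (λ k → walk k (v ∷ vs)) (ℕ.*-comm N 7) ⟩
      walk (7 ℕ.* N) (v ∷ vs)           ≈⟨ walk-rounds 7 v vs ⟩
      fromℕ 7 * cyclicWeight I (v ∷ vs) ∎
      where N = length (v ∷ vs)

    -- Greedy tours

    Covered : List (Fin n) → Fin n → Set
    Covered T v = ∃ λ u → u ∈ T × cell u ≡ cell v

    covered? : ∀ T v → Dec (Covered T v)
    covered? T v with any? (λ u → ≡-dec ℤ._≟_ ℤ._≟_ (cell u) (cell v)) T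
    ... | yes any = yes (find any)
    ... | no ¬any = no λ (u , u∈T , eq) → ¬any (lose u∈T eq)

    same-cell : ∀ {vs x y} → Unique (map cell vs) → x ∈ vs → y ∈ vs → cell x ≡ cell y → x ≡ y
    same-cell (_ ∷ _)   (here ≡.refl) (here ≡.refl) _  = ≡.refl
    same-cell (x∉ ∷ _)  (here ≡.refl) (there y∈)    eq = contradiction eq (All.lookup x∉ (∈-map⁺ cell y∈))
    same-cell (x∉ ∷ _)  (there x∈)    (here ≡.refl) eq = contradiction (≡.sym eq) (All.lookup x∉ (∈-map⁺ cell x∈))
    same-cell (_ ∷ vs!) (there x∈)    (there y∈)    eq = same-cell vs! x∈ y∈ eq

    -- M is the total weight of the edges (u , v) chosen, not that of the tour T.
    data Greedy (r : Fin n) : List (Fin n) → Carrier → Set where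
      root  : Greedy r [ r ] 0#
      grow  : ∀ {xs u ys v M} → Greedy r (xs ++ u ∷ ys) M → ¬ Covered (xs ++ u ∷ ys) v →
              (∀ u′ v′ → u′ ∈ xs ++ u ∷ ys → ¬ Covered (xs ++ u ∷ ys) v′ → weight u v ≤ weight u′ v′) →
              Greedy r (xs ++ u ∷ v ∷ ys) (M + weight u v)

    insert-↭ : ∀ xs (u v : Fin n) ys → xs ++ u ∷ v ∷ ys ↭ v ∷ xs ++ u ∷ ys
    insert-↭ xs u v ys = ≡.subst₂ (λ as bs → as ↭ v ∷ bs)
      (List.++-assoc xs [ u ] (v ∷ ys)) (List.++-assoc xs [ u ] ys) (shift v (xs ++ [ u ]) ys)

    module _ {xs : List (Fin n)} {u v : Fin n} {ys : List (Fin n)} where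
      private
        T  = xs ++ u ∷ ys
        T′ = xs ++ u ∷ v ∷ ys

      ∈-insert-old : ∀ {x} → x ∈ T → x ∈ T′
      ∈-insert-old x∈T = ∈-resp-↭ (↭-sym (insert-↭ xs u v ys)) (there x∈T)

      ∈-insert-new : v ∈ T′
      ∈-insert-new = ∈-resp-↭ (↭-sym (insert-↭ xs u v ys)) (here ≡.refl)

      covered-insert : ∀ {x} → Covered T x → Covered T′ x
      covered-insert (y , y∈T , eq) = y , ∈-insert-old y∈T , eq

      covered-insert⁻ : ∀ {x} → Covered T′ x → cell v ≡ cell x ⊎ Covered T x
      covered-insert⁻ (y , y∈T′ , eq) with ∈-resp-↭ (insert-↭ xs u v ys) y∈T′
      ... | here ≡.refl = inj₁ eq
      ... | there y∈T   = inj₂ (y , y∈T , eq)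

    greedy-root : ∀ {r T M} → Greedy r T M → r ∈ T
    greedy-root root                     = here ≡.refl
    greedy-root (grow {xs} {u} {ys} {v} g _ _) = ∈-insert-old {xs} {u} {v} {ys} (greedy-root g)

    greedy-unique : ∀ {r T M} → Greedy r T M → Unique (map cell T)
    greedy-unique root = [] ∷ []
    greedy-unique (grow {xs} {u} {ys} {v} g v∉ _) =
      Permutation.Unique-resp-↭ (≡.setoid Cell) (↭⇒↭ₛ (map⁺ cell (↭-sym (insert-↭ xs u v ys))))
        (All.tabulate (λ c∈ eq → let (y , y∈ , eq′) = ∈-map⁻ cell c∈ in
           v∉ (y , y∈ , ≡.sym (≡.trans eq eq′))) ∷ greedy-unique g)

    greedy-weight : ∀ {r T M} → Greedy r T M → cyclicWeight I T ≤ M + M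
    greedy-weight {r} root = ≤-trans (dist-self (point r)) (≤-reflexive (sym (+-identityˡ 0#)))
    greedy-weight (grow {xs} {u} {ys} {v} {M} g _ _) = begin
      cyclicWeight I (xs ++ u ∷ v ∷ ys)                           ≤⟨ cyclicWeight-insert xs u v ys ⟩
      cyclicWeight I (xs ++ u ∷ ys) + (weight u v + weight u v)   ≤⟨ +-mono-≤ (greedy-weight g) ≤-refl ⟩
      M + M + (weight u v + weight u v)
        ≈⟨ solve 2 (λ m c → m :+ m :+ (c :+ c) := (m :+ c) :+ (m :+ c)) refl M (weight u v) ⟩
      (M + weight u v) + (M + weight u v)                         ∎

    unique-cells⇒length-≤ : ∀ {us vs} → Unique (map cell us) → (∀ {u} → u ∈ us → Covered vs u) → length us ℕ.≤ length vs
    unique-cells⇒length-≤ {us} {vs} us! covered = ≡.subst₂ ℕ._≤_ (List.length-map cell us) (List.length-map cell vs)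
      (unique-⊆⇒length-≤ us! λ c∈ → let (u , u∈us , eq) = ∈-map⁻ cell c∈
                                        (v , v∈vs , eq′) = covered u∈us
                                    in ≡.subst (_∈ map cell vs) (≡.trans eq′ (≡.sym eq)) (∈-map⁺ cell v∈vs))

    -- Comparison with a feasible tour through the root

    module Comparison (r : Fin n) (us : List (Fin n)) (tour! : Unique (map cell (r ∷ us)))
                      (tour-covers : ∀ v → Covered (r ∷ us) v) where

      L : Carrier
      L = cyclicWeight I (r ∷ us)

      private
        uncovered-∈ : ∀ {T v} → r ∈ T → ¬ Covered T v → ∃ λ q → q ∈ us × cell q ≡ cell v
        uncovered-∈ {v = v} r∈T v∉ with tour-covers v
        ... | _ , here ≡.refl , eq = contradiction (r , r∈T , eq) v∉
        ... | q , there q∈us , eq  = q , q∈us , eq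

        ¬covered-resp : ∀ {T x y} → cell x ≡ cell y → ¬ Covered T y → ¬ Covered T x
        ¬covered-resp eq ¬y (z , z∈T , eq′) = ¬y (z , z∈T , ≡.trans eq′ eq)

      -- The vertices `r` and `q` cut the cycle into two arcs, neither of them lighter than the edge
      -- between its ends.
      round-trip : ∀ {q} → q ∈ us → weight r q + weight r q ≤ L
      round-trip {q} q∈us with ∈-∃++ q∈us
      ... | as , bs , ≡.refl = begin
        weight r q + weight r q               ≤⟨ +-mono-≤ ≤-refl (≤-trans (weight-sym-≤ r q)
                                                   (weight≤path {q} {bs ++ [ r ]} (here ≡.refl) (there (∈-++⁺ʳ bs (here ≡.refl))))) ⟩
        weight r q + path q (bs ++ [ r ])     ≤⟨ path-skip r as q (bs ++ [ r ]) ⟩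
        path r (as ++ q ∷ bs ++ [ r ])        ≡⟨ ≡.cong (path r) (List.++-assoc as (q ∷ bs) [ r ]) ⟨
        path r ((as ++ q ∷ bs) ++ [ r ])      ≈⟨ cyclicWeight≈path r (as ++ q ∷ bs) ⟨
        cyclicWeight I (r ∷ as ++ q ∷ bs)     ∎

      -- The new edge is no heavier than the one from the root to the vertex of `us` in the new
      -- cell, and twice that edge is at most `L`. The summand `L` on the left avoids the difference
      -- `length T - 1`.
      greedy-star : ∀ {T M} → Greedy r T M → M + M + L ≤ fromℕ (length T) * L
      greedy-star root = ≤-reflexive (solve 1 (λ l → con 0 :+ con 0 :+ l := (con 1 :+ con 0) :* l) refl L)
      greedy-star (grow {xs} {u} {ys} {v} {M} g v∉ nearest) with uncovered-∈ (greedy-root g) v∉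
      ... | q , q∈us , eq = begin
        M + c + (M + c) + L                           ≈⟨ solve 3 (λ m c l → m :+ c :+ (m :+ c) :+ l := m :+ m :+ l :+ (c :+ c)) refl M c L ⟩
        M + M + L + (c + c)                           ≤⟨ +-mono-≤ (greedy-star g) (≤-trans (+-mono-≤ c≤ c≤) (round-trip q∈us)) ⟩
        fromℕ (length (xs ++ u ∷ ys)) * L + L         ≈⟨ solve 2 (λ k l → k :* l :+ l := (con 1 :+ k) :* l) refl _ L ⟩
        fromℕ (suc (length (xs ++ u ∷ ys))) * L       ≡⟨ ≡.cong (λ k → fromℕ k * L) (↭-length (insert-↭ xs u v ys)) ⟨
        fromℕ (length (xs ++ u ∷ v ∷ ys)) * L         ∎
        where
        c = weight u v
        c≤ : c ≤ weight r q
        c≤ = nearest r q (greedy-root g) (¬covered-resp eq v∉)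

      private
        -- An edge plus one cell diagonal: what it may cost once one of its ends is replaced by
        -- another point of the same cell.
        W : Fin n → Fin n → Carrier
        W p x = weight p x + √ 2#

        0≤√2 : 0# ≤ √ 2#
        0≤√2 = √-nonneg 2# (fromℕ-nonneg 2)

        -- The rest of the tour after p is cut by the vertices in A into gaps;
        -- at most one edge of each gap is dropped and G is the total W-weight
        -- of the others.  The flag tells whether the gap in which p lies has
        -- lost its edge already.
        data Gaps (A : Fin n → Set) : Fin n → List (Fin n) → Bool → Carrier → Set where
          end    : ∀ {p} → A p → Gaps A p [] false 0#
          keep-∈ : ∀ {p x xs d G} → A x → Gaps A x xs false G → Gaps A p (x ∷ xs) d (W p x + G)
          keep-∉ : ∀ {p x xs d G} → ¬ A x → Gaps A x xs d G → Gaps A p (x ∷ xs) d (W p x + G)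
          drop-∈ : ∀ {p x xs G} → A x → Gaps A x xs false G → Gaps A p (x ∷ xs) false G
          drop-∉ : ∀ {p x xs G} → ¬ A x → Gaps A x xs true G → Gaps A p (x ∷ xs) false G

        gaps-nonneg : ∀ {A p xs d G} → Gaps A p xs d G → 0# ≤ G
        gaps-nonneg (end _) = ≤-refl
        gaps-nonneg (keep-∈ _ g) = +-nonneg (+-nonneg (weight-nonneg _ _) 0≤√2) (gaps-nonneg g)
        gaps-nonneg (keep-∉ _ g) = +-nonneg (+-nonneg (weight-nonneg _ _) 0≤√2) (gaps-nonneg g)
        gaps-nonneg (drop-∈ _ g) = gaps-nonneg g
        gaps-nonneg (drop-∉ _ g) = gaps-nonneg g

        -- When an edge of weight c reaches q, some kept edge at least as heavy can
        -- be dropped in exchange.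
        module Visit {A A′ : Fin n → Set} (A⊆A′ : ∀ {x} → A x → A′ x) (c : Carrier)
                     (cross : ∀ p x → A p → ¬ A x → c ≤ W p x) (cross′ : ∀ p x → ¬ A p → A x → c ≤ W p x) where

          Unchanged : List (Fin n) → Set
          Unchanged xs = ∀ {x} → x ∈ xs → A′ x → A x

          Cheaper : Fin n → List (Fin n) → Bool → Carrier → Set
          Cheaper p xs d G = ∃ λ G′ → Gaps A′ p xs d G′ × G′ + c ≤ G

          transfer : ∀ {p xs d G} → Unchanged xs → Gaps A p xs d G → Gaps A′ p xs d G
          transfer un (end a)      = end (A⊆A′ a)
          transfer un (keep-∈ a g) = keep-∈ (A⊆A′ a) (transfer (un ∘ there) g)
          transfer un (keep-∉ a g) = keep-∉ (a ∘ un (here ≡.refl)) (transfer (un ∘ there) g)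
          transfer un (drop-∈ a g) = drop-∈ (A⊆A′ a) (transfer (un ∘ there) g)
          transfer un (drop-∉ a g) = drop-∉ (a ∘ un (here ≡.refl)) (transfer (un ∘ there) g)

          keep-cheaper : ∀ {w G G′} → G′ + c ≤ G → w + G′ + c ≤ w + G
          keep-cheaper le = ≤-trans (≤-reflexive (+-assoc _ _ _)) (+-mono-≤ ≤-refl le)

          drop-cheaper : ∀ {w G} → c ≤ w → G + c ≤ w + G
          drop-cheaper {w} {G} c≤w = ≤-trans (≤-reflexive (+-comm G c)) (+-mono-≤ c≤w ≤-refl)

          -- The walk has to enter a visited vertex again, since `end` asks for one. The entering
          -- edge of the current gap is kept, because the flag says that this gap has lost its edge
          -- earlier, and it leads from an unvisited to a visited vertex.
          drop-last : ∀ {p xs G} → ¬ A p → Unchanged xs → Gaps A p xs true G → Cheaper p xs false G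
          drop-last ¬Ap un (keep-∈ a g) = _ , drop-∈ (A⊆A′ a) (transfer (un ∘ there) g) , drop-cheaper (cross′ _ _ ¬Ap a)
          drop-last ¬Ap un (keep-∉ a g) with drop-last a (un ∘ there) g
          ... | G′ , g′ , le = _ , keep-∉ (a ∘ un (here ≡.refl)) g′ , keep-cheaper le

          module _ {q : Fin n} (¬Aq : ¬ A q) (A′q : A′ q) where

            mutual
              -- Unless some edge can be dropped already, the edges up to q are
              -- all kept, so that the caller may drop the first edge of the gap.
              visit-inside : ∀ as {bs p d G} → ¬ A p → Unchanged as → Unchanged bs → Gaps A p (as ++ q ∷ bs) d G →
                             Cheaper p (as ++ q ∷ bs) d G ⊎ d ≡ false × Gaps A′ p (as ++ q ∷ bs) true G
              visit-inside [] ¬Ap ua ub (keep-∈ a g) = contradiction a ¬Aq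
              visit-inside [] ¬Ap ua ub (drop-∈ a g) = contradiction a ¬Aq
              visit-inside [] {d = true} ¬Ap ua ub (keep-∉ a g) with drop-last a ub g
              ... | G′ , g′ , le = inj₁ (_ , keep-∈ A′q g′ , keep-cheaper le)
              -- A new gap opens at `q`, so the flag in front of `q` may be raised: nothing before
              -- `q` needs it to be `false`.
              visit-inside [] {d = false} ¬Ap ua ub (keep-∉ a g) = inj₂ (≡.refl , keep-∈ A′q (transfer ub g))
              visit-inside [] ¬Ap ua ub (drop-∉ a g) with drop-last a ub g
              ... | G′ , g′ , le = inj₁ (_ , drop-∈ A′q g′ , le)
              visit-inside (x ∷ as) ¬Ap ua ub (keep-∈ a g) with visit as a (ua ∘ there) ub g
              ... | G′ , g′ , le = inj₁ (_ , keep-∈ (A⊆A′ a) g′ , keep-cheaper le)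
              visit-inside (x ∷ as) ¬Ap ua ub (drop-∈ a g) with visit as a (ua ∘ there) ub g
              ... | G′ , g′ , le = inj₁ (_ , drop-∈ (A⊆A′ a) g′ , le)
              visit-inside (x ∷ as) ¬Ap ua ub (keep-∉ a g) with visit-inside as a (ua ∘ there) ub g
              ... | inj₁ (G′ , g′ , le) = inj₁ (_ , keep-∉ (a ∘ ua (here ≡.refl)) g′ , keep-cheaper le)
              ... | inj₂ (eq , g′)      = inj₂ (eq , keep-∉ (a ∘ ua (here ≡.refl)) g′)
              visit-inside (x ∷ as) ¬Ap ua ub (drop-∉ a g) with visit-inside as a (ua ∘ there) ub g
              ... | inj₁ (G′ , g′ , le) = inj₁ (_ , drop-∉ (a ∘ ua (here ≡.refl)) g′ , le)
              ... | inj₂ (() , _)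

              -- The gap around `q` splits in two, each half with a drop of its own. If an edge
              -- before `q` is gone already, the last edge of the gap goes now; otherwise the first
              -- one goes. Either joins a visited vertex to an unvisited one and so weighs at least
              -- `c`.
              visit : ∀ as {bs p G} → A p → Unchanged as → Unchanged bs → Gaps A p (as ++ q ∷ bs) false G →
                      Cheaper p (as ++ q ∷ bs) false G
              visit [] Ap ua ub (keep-∈ a g) = contradiction a ¬Aq
              visit [] Ap ua ub (drop-∈ a g) = contradiction a ¬Aq
              visit [] Ap ua ub (keep-∉ a g) = _ , drop-∈ A′q (transfer ub g) , drop-cheaper (cross _ _ Ap a)
              visit [] Ap ua ub (drop-∉ a g) with drop-last a ub g
              ... | G′ , g′ , le = _ , drop-∈ A′q g′ , le
              visit (x ∷ as) Ap ua ub (keep-∈ a g) with visit as a (ua ∘ there) ub g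
              ... | G′ , g′ , le = _ , keep-∈ (A⊆A′ a) g′ , keep-cheaper le
              visit (x ∷ as) Ap ua ub (drop-∈ a g) with visit as a (ua ∘ there) ub g
              ... | G′ , g′ , le = _ , drop-∈ (A⊆A′ a) g′ , le
              visit (x ∷ as) Ap ua ub (keep-∉ a g) with visit-inside as a (ua ∘ there) ub g
              ... | inj₁ (G′ , g′ , le) = _ , keep-∉ (a ∘ ua (here ≡.refl)) g′ , keep-cheaper le
              ... | inj₂ (_ , g′)       = _ , drop-∉ (a ∘ ua (here ≡.refl)) g′ , drop-cheaper (cross _ _ Ap a)
              visit (x ∷ as) Ap ua ub (drop-∉ a g) with visit-inside as a (ua ∘ there) ub g
              ... | inj₁ (G′ , g′ , le) = _ , drop-∉ (a ∘ ua (here ≡.refl)) g′ , le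
              ... | inj₂ (() , _)

        -- Reaching `x` from `u` by way of `p` adds at most the diagonal of the cell that `u` and
        -- `p` share.
        crossing : ∀ {T c} → (∀ u v → u ∈ T → ¬ Covered T v → c ≤ weight u v) →
                   ∀ p x → Covered T p → ¬ Covered T x → c ≤ W p x
        crossing {T} {c} nearest p x (u , u∈T , eq) x∉ = begin
          c                           ≤⟨ nearest u x u∈T x∉ ⟩
          weight u x                  ≤⟨ weight-triangle u p x ⟩
          weight u p + weight p x     ≤⟨ +-mono-≤ (dist-same-cell {c = cell u} (inCell u) (≡.subst (point p InCell_) (≡.sym eq) (inCell p))) ≤-refl ⟩
          √ 2# + weight p x           ≈⟨ +-comm _ _ ⟩
          W p x                       ∎

        initial-gaps : ∀ p vs → (∀ {v} → v ∈ vs → ¬ Covered [ r ] v) →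
                       ∃ λ G → Gaps (Covered [ r ]) p (vs ++ [ r ]) false G × G ≤ path p (vs ++ [ r ]) + fromℕ (suc (length vs)) * √ 2#
        initial-gaps p [] _ = _ , keep-∈ r∈ (end r∈) ,
          ≤-reflexive (solve 2 (λ w s → w :+ s :+ con 0 := w :+ con 0 :+ (con 1 :+ con 0) :* s) refl (weight p r) (√ 2#))
          where r∈ = r , here ≡.refl , ≡.refl
        initial-gaps p (v ∷ vs) ∉ with initial-gaps v vs (∉ ∘ there)
        ... | G , g , G≤ = _ , keep-∉ (∉ (here ≡.refl)) g , (begin
          W p v + G                                                 ≤⟨ +-mono-≤ ≤-refl G≤ ⟩
          W p v + (path v (vs ++ [ r ]) + fromℕ (suc (length vs)) * √ 2#)
            ≈⟨ solve 4 (λ w s P k → w :+ s :+ (P :+ k :* s) := w :+ P :+ (con 1 :+ k) :* s) refl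
                 (weight p v) (√ 2#) (path v (vs ++ [ r ])) (fromℕ (suc (length vs))) ⟩
          weight p v + path v (vs ++ [ r ]) + fromℕ (suc (suc (length vs))) * √ 2# ∎)

        Bound : Carrier
        Bound = L + fromℕ (length (r ∷ us)) * √ 2#

        -- The kept edges are a budget: initially it is the whole tour, every edge with its
        -- diagonal, and each chosen edge is paid for by a dropped one.
        greedy-gaps : ∀ {T M} → Greedy r T M → ∃ λ G → Gaps (Covered T) r (us ++ [ r ]) false G × M + G ≤ Bound
        greedy-gaps root with initial-gaps r us (λ v∈us → λ where
          (_ , here ≡.refl , eq) → All.lookup (AllPairs.head tour!) (∈-map⁺ cell v∈us) eq)
        ... | G , g , G≤ = G , g , (begin
          0# + G                                                            ≈⟨ +-identityˡ G ⟩
          G                                                                 ≤⟨ G≤ ⟩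
          path r (us ++ [ r ]) + fromℕ (suc (length us)) * √ 2#             ≈⟨ +-congʳ (cyclicWeight≈path r us) ⟨
          Bound                                                             ∎)
        greedy-gaps (grow {xs} {u} {ys} {v} {M} g v∉ nearest) with uncovered-∈ (greedy-root g) v∉ | greedy-gaps g
        ... | q , q∈us , eq | G , gaps , le with ∈-∃++ q∈us
        ...   | as , bs , us≡ = G′ , ≡.subst (λ l → Gaps _ r l false G′) (≡.sym list≡) gaps′ , (begin
          M + weight u v + G′     ≈⟨ solve 3 (λ m c g → m :+ c :+ g := m :+ (g :+ c)) refl M (weight u v) G′ ⟩
          M + (G′ + weight u v)   ≤⟨ +-mono-≤ ≤-refl le′ ⟩
          M + G                   ≤⟨ le ⟩
          Bound                   ∎)
          where
          T  = xs ++ u ∷ ys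
          T′ = xs ++ u ∷ v ∷ ys
          list≡ : us ++ [ r ] ≡ as ++ q ∷ (bs ++ [ r ])
          list≡ = ≡.trans (≡.cong (_++ [ r ]) us≡) (List.++-assoc as (q ∷ bs) [ r ])
          us!′ : Unique (map cell (q ∷ as ++ bs))
          us!′ = Permutation.Unique-resp-↭ (≡.setoid Cell) (↭⇒↭ₛ (map⁺ cell (shift q as bs)))
            (≡.subst (Unique ∘ map cell) us≡ (AllPairs.tail tour!))
          -- The compared tour has one vertex per cell, so the new point changes the status of `q`
          -- alone.
          other : ∀ {x} → x ∈ as ++ bs → Covered T′ x → Covered T x
          other x∈ cov with covered-insert⁻ {xs} {u} {v} {ys} cov
          ... | inj₁ eq′ = contradiction (≡.trans eq eq′) (All.lookup (AllPairs.head us!′) (∈-map⁺ cell x∈))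
          ... | inj₂ c   = c
          after : ∀ {x} → x ∈ bs ++ [ r ] → Covered T′ x → Covered T x
          after x∈ cov with ∈-++⁻ bs x∈
          ... | inj₁ x∈bs          = other (∈-++⁺ʳ as x∈bs) cov
          ... | inj₂ (here ≡.refl) = r , greedy-root g , ≡.refl
          visited = Visit.visit {Covered T} {Covered T′} (covered-insert {xs} {u} {v} {ys}) (weight u v)
            (crossing nearest) (λ p x p∉ x∈ → ≤-trans (crossing nearest x p x∈ p∉) (+-mono-≤ (weight-sym-≤ x p) ≤-refl))
            (¬covered-resp eq v∉) (v , ∈-insert-new {xs} {u} {v} {ys} , ≡.sym eq)
            as (r , greedy-root g , ≡.refl) (other ∘ ∈-++⁺ˡ) after
            (≡.subst (λ l → Gaps (Covered T) r l false G) list≡ gaps)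
          G′    = proj₁ visited
          gaps′ = proj₁ (proj₂ visited)
          le′   = proj₂ (proj₂ visited)

      greedy-tree : ∀ {T M} → Greedy r T M → M ≤ L + fromℕ (length (r ∷ us)) * √ 2#
      greedy-tree g with greedy-gaps g
      ... | G , gaps , le = ≤-trans (x≤x+y (gaps-nonneg gaps)) le

      greedy-ratio : ∀ {T M} → Greedy r T M → M + M ≤ (2# + fromℕ 7 * √ 2#) * L
      greedy-ratio {T} {M} g with 8 ℕ.≤? length (r ∷ us)
      ... | yes 8≤ = begin
        M + M                                         ≤⟨ +-mono-≤ (greedy-tree g) (greedy-tree g) ⟩
        L + N * √ 2# + (L + N * √ 2#)
          ≈⟨ solve 3 (λ l n s → l :+ n :* s :+ (l :+ n :* s) := (con 1 :+ (con 1 :+ con 0)) :* l :+ (n :* (con 1 :+ (con 1 :+ con 0))) :* s) refl L N (√ 2#) ⟩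
        2# * L + N * 2# * √ 2#                        ≤⟨ +-mono-≤ ≤-refl (≤-trans (≤-reflexive (*-comm _ _)) (≤-trans (*-monoˡ-≤ 0≤√2 (cycle-lower-bound (r ∷ us) tour! 8≤)) (≤-reflexive (*-comm _ _)))) ⟩
        2# * L + fromℕ 7 * L * √ 2#                   ≈⟨ solve 4 (λ t l k s → t :* l :+ k :* l :* s := (t :+ k :* s) :* l) refl 2# L (fromℕ 7) (√ 2#) ⟩
        (2# + fromℕ 7 * √ 2#) * L                     ∎
        where N = fromℕ (length (r ∷ us))
      -- Here the star bound suffices: it gives `fromℕ 7`, which 1 ≤ √2 places below the ratio.
      ... | no 8≰ = begin
        M + M                       ≤⟨ x≤x+y 0≤L ⟩
        M + M + L                   ≤⟨ greedy-star g ⟩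
        fromℕ (length T) * L        ≤⟨ *-mono-≤ (fromℕ-nonneg (length T)) 0≤L (fromℕ-mono-≤ length≤7) ≤-refl ⟩
        fromℕ 7 * L                 ≤⟨ *-mono-≤ (fromℕ-nonneg 7) 0≤L 7≤ ≤-refl ⟩
        (2# + fromℕ 7 * √ 2#) * L   ∎
        where
        0≤L : 0# ≤ L
        0≤L = ≤-trans (path-nonneg r (us ++ [ r ])) (≤-reflexive (sym (cyclicWeight≈path r us)))
        length≤7 : length T ℕ.≤ 7
        length≤7 = ℕ.≤-trans (unique-cells⇒length-≤ (greedy-unique g) (λ {u} _ → tour-covers u)) (ℕ.≤-pred (ℕ.≰⇒> 8≰))
        7≤ : fromℕ 7 ≤ 2# + fromℕ 7 * √ 2#
        7≤ = begin
          fromℕ 7                   ≈⟨ *-identityʳ _ ⟨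
          fromℕ 7 * 1#              ≤⟨ *-monoˡ-≤ (fromℕ-nonneg 7) 1≤√2 ⟩
          fromℕ 7 * √ 2#            ≤⟨ x≤y+x (fromℕ-nonneg 2) ⟩
          2# + fromℕ 7 * √ 2#       ∎

    -- Rules of total correctness

    -- Total correctness within the cost, in continuation style.
    Ends : Program → State → (State → Set) → Set
    Ends p s Q = ∃ λ t → ∃ λ s′ → t ℕ.≤ cost n p × Run p s t s′ × Q s′

    ends-skip : ∀ {s Q} → Q s → Ends skip s Q
    ends-skip q = 1 , _ , ℕ.≤-refl , run-skip , q

    ends-nat : ∀ {s a e Q} → Q ⟨ natMem s [ evalN s a ↦ evalN s e ] , realMem s ⟩ → Ends (N[ a ]≔ e) s Q
    ends-nat q = 1 , _ , ℕ.≤-refl , run-nat , q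

    ends-real : ∀ {s a e Q} → Q ⟨ natMem s , realMem s [ evalN s a ↦ evalR s e ] ⟩ → Ends (R[ a ]≔ e) s Q
    ends-real q = 1 , _ , ℕ.≤-refl , run-real , q

    ends-seq : ∀ {p q s Q} → Ends p s (λ s′ → Ends q s′ Q) → Ends (p ﹔ q) s Q
    ends-seq (t , s′ , t≤ , run , t′ , s″ , t′≤ , run′ , q) = _ , s″ , ℕ.+-mono-≤ t≤ t′≤ , run-seq run run′ , q

    ends-if : ∀ {b p q s Q} → (evalB s b ≡ true → Ends p s Q) → (evalB s b ≡ false → Ends q s Q) →
              Ends (if′ b then′ p else′ q) s Q
    ends-if {b} {p} {q} {s} then else with evalB s b in eq
    ... | true  = let (t , s′ , t≤ , run , q) = then ≡.refl in
                  _ , s′ , ℕ.s≤s (ℕ.≤-trans t≤ (ℕ.m≤m+n _ _)) , run-then eq run , q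
    ... | false = let (t , s′ , t≤ , run , q) = else ≡.refl in
                  _ , s′ , ℕ.s≤s (ℕ.≤-trans t≤ (ℕ.m≤n+m _ (cost n p))) , run-else eq run , q

    ends-mono : ∀ {p s Q Q′} → (∀ {s} → Q s → Q′ s) → Ends p s Q → Ends p s Q′
    ends-mono Q⊆Q′ (t , s′ , t≤ , run , q) = t , s′ , t≤ , run , Q⊆Q′ q

    -- The index of the invariant counts the iterations still to come: it is the termination measure
    -- and, being at most `n`, yields the factor `n` of `cost`.
    ends-while : ∀ {b p s} (Inv : ℕ → State → Set) →
      (∀ k s → Inv (suc k) s → evalB s b ≡ true × Ends p s (Inv k)) →
      (∀ s → Inv 0 s → evalB s b ≡ false) →
      ∀ k → k ℕ.≤ n → Inv k s → Ends (while′ b do′ p) s (Inv 0)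
    ends-while {b} {p} Inv body exit k k≤n inv = let (t , s′ , t≤ , run , q) = go k inv in
      t , s′ , ℕ.≤-trans t≤ (ℕ.s≤s (ℕ.*-monoˡ-≤ (suc (cost n p)) k≤n)) , run , q
      where
      go : ∀ {s} k → Inv k s → ∃ λ t → ∃ λ s′ → t ℕ.≤ suc (k ℕ.* suc (cost n p)) × Run (while′ b do′ p) s t s′ × Inv 0 s′
      go zero    inv = 1 , _ , ℕ.≤-refl , run-done (exit _ inv) , inv
      go (suc k) inv with body k _ inv
      ... | eq , t , s′ , t≤ , run , inv′ with go k inv′
      ... | t′ , s″ , t′≤ , run′ , q = _ , s″ , ℕ.s≤s bound , run-loop eq run run′ , q
        where
        bound : t ℕ.+ t′ ℕ.≤ suc (cost n p) ℕ.+ k ℕ.* suc (cost n p)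
        bound = ℕ.≤-trans (ℕ.+-mono-≤ t≤ t′≤) (ℕ.≤-reflexive (ℕ.+-suc (cost n p) _))

    -- The bound `b` is evaluated anew in every test, so the invariant has to guarantee its value.
    -- The body is followed by the increment, whence the updated memory in its postcondition.
    ends-for : ∀ {r b p s Q} m → m ℕ.≤ n → (Inv : ℕ → State → Set) →
      (∀ {i s} → Inv i s → natMem s r ≡ i × evalN s b ≡ m) →
      Inv 0 ⟨ natMem s [ r ↦ 0 ] , realMem s ⟩ →
      (∀ i s → i ℕ.< m → Inv i s →
        Ends p s (λ s′ → Inv (suc i) ⟨ natMem s′ [ r ↦ suc (natMem s′ r) ] , realMem s′ ⟩)) →
      (∀ {s} → Inv m s → Q s) →
      Ends (for r upTo b do′ p) s Q
    ends-for {r} {b} m m≤n Inv counters init body final = ends-seq (ends-nat (ends-mono exit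
      (ends-while (λ k s → ∃ λ i → i ℕ.+ k ≡ m × Inv i s) loop done m m≤n (0 , ≡.refl , init))))
      where
      exit : ∀ {s} → (∃ λ i → i ℕ.+ 0 ≡ m × Inv i s) → _
      exit (i , eq , inv) = final (≡.subst (λ i → Inv i _) (≡.trans (≡.sym (ℕ.+-identityʳ i)) eq) inv)
      done : ∀ s → (∃ λ i → i ℕ.+ 0 ≡ m × Inv i s) → _
      done s (i , eq , inv) = let (r≡ , b≡) = counters inv in dec-false (_ ℕ.≤? _)
        (λ le → ℕ.1+n≰n (≡.subst₂ (λ x y → suc x ℕ.≤ y) r≡ (≡.trans b≡ (≡.trans (≡.sym eq) (ℕ.+-identityʳ i))) le))
      loop : ∀ k s → (∃ λ i → i ℕ.+ suc k ≡ m × Inv i s) → _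
      loop k s (i , eq , inv) = let (r≡ , b≡) = counters inv in
        dec-true (_ ℕ.≤? _) (≡.subst₂ (λ x y → suc x ℕ.≤ y) (≡.sym r≡) (≡.sym b≡) i<m) ,
        ends-seq (ends-mono (λ inv′ → ends-nat (suc i , ≡.trans (≡.sym (ℕ.+-suc i k)) eq , inv′)) (body i s i<m inv))
        where
        i<m : i ℕ.< m
        i<m = ≡.subst (suc i ℕ.≤_) (≡.trans (≡.sym (ℕ.+-suc i k)) eq) (ℕ.s≤s (ℕ.m≤m+n i k))

    -- Lists in memory

    ↦-same : ∀ {A : Set} (m : ℕ → A) k v → (m [ k ↦ v ]) k ≡ v
    ↦-same m k v rewrite dec-true (k ℕ.≟ k) ≡.refl = ≡.refl

    ↦-other : ∀ {A : Set} (m : ℕ → A) {k v l} → l ≢ k → (m [ k ↦ v ]) l ≡ m l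
    ↦-other m {k} {v} {l} l≢k rewrite dec-false (l ℕ.≟ k) l≢k = ≡.refl

    Holds : (ℕ → ℕ) → ℕ → List (Fin n) → Set
    Holds m b []       = ⊤
    Holds m b (x ∷ xs) = m b ≡ toℕ x × Holds m (suc b) xs

    holds-cong : ∀ {m m′} b xs → (∀ j → b ℕ.≤ j → j ℕ.< b ℕ.+ length xs → m′ j ≡ m j) → Holds m b xs → Holds m′ b xs
    holds-cong b []       eq _       = tt
    holds-cong b (x ∷ xs) eq (h , t) =
      ≡.trans (eq b ℕ.≤-refl (≡.subst (suc b ℕ.≤_) (≡.sym (ℕ.+-suc b (length xs))) (ℕ.s≤s (ℕ.m≤m+n b (length xs))))) h ,
      holds-cong (suc b) xs (λ j b≤ j< → eq j (ℕ.<⇒≤ b≤) (≡.subst (j ℕ.<_) (≡.sym (ℕ.+-suc b (length xs))) j<)) t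

    holds-join : ∀ {m} b xs {ys} → Holds m b xs → Holds m (b ℕ.+ length xs) ys → Holds m b (xs ++ ys)
    holds-join {m} b []       {ys} _       h′ = ≡.subst (λ j → Holds m j ys) (ℕ.+-identityʳ b) h′
    holds-join {m} b (x ∷ xs) {ys} (h , t) h′ =
      h , holds-join (suc b) xs t (≡.subst (λ j → Holds m j ys) (ℕ.+-suc b (length xs)) h′)

    holds-split : ∀ {m} b xs {ys} → Holds m b (xs ++ ys) → Holds m b xs × Holds m (b ℕ.+ length xs) ys
    holds-split {m} b []       {ys} h       = tt , ≡.subst (λ j → Holds m j ys) (≡.sym (ℕ.+-identityʳ b)) h
    holds-split {m} b (x ∷ xs) {ys} (h , t) = let (h₁ , h₂) = holds-split (suc b) xs t in
      (h , h₁) , ≡.subst (λ j → Holds m j ys) (≡.sym (ℕ.+-suc b (length xs))) h₂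

    holds-lookup : ∀ {m} b xs {y ys} → Holds m b (xs ++ y ∷ ys) → m (b ℕ.+ length xs) ≡ toℕ y
    holds-lookup b xs h = proj₁ (proj₂ (holds-split b xs h))

    holds-write-after : ∀ {m} b xs {a x} → b ℕ.+ length xs ℕ.≤ a → Holds m b xs → Holds (m [ a ↦ x ]) b xs
    holds-write-after {m} b xs le = holds-cong b xs (λ j _ j< → ↦-other m (ℕ.<⇒≢ (ℕ.<-≤-trans j< le)))

    holds-write-before : ∀ {m} b xs {a x} → a ℕ.< b → Holds m b xs → Holds (m [ a ↦ x ]) b xs
    holds-write-before {m} b xs a<b = holds-cong b xs (λ j b≤j _ → ↦-other m (ℕ.<⇒≢ (ℕ.<-≤-trans a<b b≤j) ∘ ≡.sym))

    holds-snoc : ∀ {m} b xs {y} → Holds m b xs → Holds (m [ b ℕ.+ length xs ↦ toℕ y ]) b (xs ++ [ y ])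
    holds-snoc {m} b xs h = holds-join b xs (holds-write-after b xs ℕ.≤-refl h) (↦-same m _ _ , tt)

    holds-output : ∀ {m b} xs → Holds m b xs → ∀ {f} → (∀ k → f k ≡ m (b ℕ.+ k)) → applyUpTo f (length xs) ≡ map toℕ xs
    holds-output []       _       eq = ≡.refl
    holds-output {m} {b} (x ∷ xs) (h , t) eq = ≡.cong₂ _∷_
      (≡.trans (eq 0) (≡.trans (≡.cong m (ℕ.+-identityʳ b)) h))
      (holds-output xs t (λ k → ≡.trans (eq (suc k)) (≡.cong m (ℕ.+-suc b k))))

    atPoint-toℕ : ∀ f {k i} → k ≡ toℕ i → atPoint f k ≡ f i
    atPoint-toℕ f {k} {i} ≡.refl with toℕ i ℕ.<? n
    ... | yes p = ≡.cong f (Fin.fromℕ<-toℕ i p)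
    ... | no ¬p = contradiction (Fin.toℕ<n i) ¬p

    -- Registers have numerals below 16 as addresses, so a write to one leaves `heap` unchanged by
    -- mere computation, and a write at `16 + k` computes to a write at `k` of `heap`.
    heap : State → ℕ → ℕ
    heap s j = natMem s (16 ℕ.+ j)

    length-≤-n : ∀ {T} → Unique (map cell T) → length T ℕ.≤ n
    length-≤-n {T} T! = ≡.subst (length T ℕ.≤_) (List.length-tabulate {n = n} (λ i → i))
      (unique-⊆⇒length-≤ (Unique.map⁻ T!) (λ _ → ∈-allFin _))

    greedy-length : ∀ {r T M} → Greedy r T M → length T ℕ.≤ n
    greedy-length g = length-≤-n (greedy-unique g)

    Full : Fin n → List (Fin n) → Carrier → Set
    Full r T M = Greedy r T M × (∀ v → Covered T v)

    -- Ties make the greedy tour of a root ambiguous. Some completed tour per root is enough, since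
    -- the comparison holds for each of them.
    Beats : ℕ → Carrier → Set
    Beats i Mb = ∀ r → toℕ r ℕ.< i → ∃ λ T → ∃ λ M → Full r T M × Mb ≤ M

    -- Index `n` of the heap is the first that the working tour, with at most `n` vertices, cannot
    -- reach.
    Saved : ℕ → (ℕ → ℕ) → Carrier → Set
    Saved i h Mb = ∃ λ r → ∃ λ T → Full r T Mb × h n ≡ length T × Holds h (suc n) T × Beats i Mb

    BestSoFar : ℕ → ℕ → (ℕ → ℕ) → Carrier → Set
    BestSoFar i have h Mb = (have ≡ 0 × i ≡ 0) ⊎ (have ≡ 1 × Saved i h Mb)

    saved-write : ∀ {i h Mb a x} → a ℕ.< n → Saved i h Mb → Saved i (h [ a ↦ x ]) Mb
    saved-write {h = h} a<n (r , T , full , len , holds , beats) =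
      r , T , full , ≡.trans (↦-other h (ℕ.<⇒≢ a<n ∘ ≡.sym)) len ,
      holds-write-before (suc n) T (ℕ.m<n⇒m<1+n a<n) holds , beats

    best-write : ∀ {i have h Mb a x} → a ℕ.< n → BestSoFar i have h Mb → BestSoFar i have (h [ a ↦ x ]) Mb
    best-write a<n (inj₁ b)           = inj₁ b
    best-write a<n (inj₂ (one , b))   = inj₂ (one , saved-write a<n b)

    -- Correctness of the loops for one root

    module Growing (r : Fin n) where

      Outer : State → Set
      Outer s = natMem s 1 ≡ toℕ r × BestSoFar (toℕ r) (natMem s 10) (heap s) (realMem s 2)

      Ctx : List (Fin n) → ℕ → State → Set
      Ctx T m s = Outer s × natMem s 2 ≡ m × Greedy r T (realMem s 1) × Holds (heap s) 0 T × natMem s 9 ≡ length T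

      -- `D` relates the pairs inspected so far; the loops of the search enlarge it until it
      -- contains every pair that starts in the tour.
      Nearest : List (Fin n) → (Fin n → Fin n → Set) → ℕ → ℕ → ℕ → Carrier → Set
      Nearest T D found pos new d =
        (found ≡ 0 × (∀ u v → D u v → Covered T v)) ⊎
        (found ≡ 1 × ∃ λ xs → ∃ λ u → ∃ λ ys → ∃ λ v → T ≡ xs ++ u ∷ ys × pos ≡ length xs × new ≡ toℕ v ×
          ¬ Covered T v × d ≡ weight u v × (∀ u′ v′ → D u′ v′ → ¬ Covered T v′ → d ≤ weight u′ v′))

      Search : List (Fin n) → ℕ → (Fin n → Fin n → Set) → State → Set
      Search T m D s = Ctx T m s × Nearest T D (natMem s 6) (natMem s 7) (natMem s 8) (realMem s 0)

      -- Pairs with a covered second point constrain nothing, so `D′` may contain them freely; this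
      -- is how a covered candidate is passed over.
      nearest-⊆ : ∀ {T D D′ f p b d} → (∀ {u v} → D′ u v → ¬ Covered T v → D u v) → Nearest T D f p b d → Nearest T D′ f p b d
      nearest-⊆ {T} D′⊆D (inj₁ (f , all)) = inj₁ (f , λ u v d → cov u v d)
        where
        cov : ∀ u v → _ → Covered T v
        cov u v d with covered? T v
        ... | yes c = c
        ... | no ¬c = all u v (D′⊆D d ¬c)
      nearest-⊆ D′⊆D (inj₂ (f , xs , u , ys , v , eq , p , b , v∉ , w , all)) =
        inj₂ (f , xs , u , ys , v , eq , p , b , v∉ , w , λ u′ v′ d v′∉ → all u′ v′ (D′⊆D d v′∉) v′∉)

      sameCell-true : ∀ {s a b u v} → evalN s a ≡ toℕ u → evalN s b ≡ toℕ v → evalB s (sameCell a b) ≡ true → cell u ≡ cell v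
      sameCell-true {s} {a} {b} {u} {v} eqa eqb t
        rewrite atPoint-toℕ (λ i → fromℤ (proj₁ (cell i))) eqa | atPoint-toℕ (λ i → fromℤ (proj₁ (cell i))) eqb
              | atPoint-toℕ (λ i → fromℤ (proj₂ (cell i))) eqa | atPoint-toℕ (λ i → fromℤ (proj₂ (cell i))) eqb =
        let (xs , ys) = ∧-true t
            (x₁ , x₂) = ∧-true xs
            (y₁ , y₂) = ∧-true ys
        in ≡.cong₂ _,_
          (ℤ.≤-antisym (fromℤ-cancel-≤ (does-true (_ ≤? _) x₁)) (fromℤ-cancel-≤ (does-true (_ ≤? _) x₂)))
          (ℤ.≤-antisym (fromℤ-cancel-≤ (does-true (_ ≤? _) y₁)) (fromℤ-cancel-≤ (does-true (_ ≤? _) y₂)))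

      sameCell-false : ∀ {s a b u v} → evalN s a ≡ toℕ u → evalN s b ≡ toℕ v → evalB s (sameCell a b) ≡ false → cell u ≢ cell v
      sameCell-false {s} {a} {b} {u} {v} eqa eqb f eq
        rewrite atPoint-toℕ (λ i → fromℤ (proj₁ (cell i))) eqa | atPoint-toℕ (λ i → fromℤ (proj₁ (cell i))) eqb
              | atPoint-toℕ (λ i → fromℤ (proj₂ (cell i))) eqa | atPoint-toℕ (λ i → fromℤ (proj₂ (cell i))) eqb
              | eq
              | dec-true (fromℤ (proj₁ (cell v)) ≤? fromℤ (proj₁ (cell v))) ≤-refl
              | dec-true (fromℤ (proj₂ (cell v)) ≤? fromℤ (proj₂ (cell v))) ≤-refl
        with () ← f

      module _ {T : List (Fin n)} {m : ℕ} {D : Fin n → Fin n → Set} {v : Fin n} where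

        Flag : ℕ → ℕ → Set
        Flag k c = (c ≡ 0 × (∀ u → Seen T k u → cell u ≢ cell v)) ⊎ (c ≡ 1 × Covered T v)

        markCovered-ends : ∀ {s} → Search T m D s → natMem s 3 ≡ toℕ v → natMem s 5 ≡ 0 →
          Ends markCovered s (λ s′ → Search T m D s′ × natMem s′ 3 ≡ toℕ v ×
            (natMem s′ 5 ≡ 0 × ¬ Covered T v ⊎ natMem s′ 5 ≡ 1 × Covered T v))
        markCovered-ends search@((_ , _ , g , _ , _) , _) v≡ c≡ = ends-for {r = 4} (length T) (greedy-length g)
          (λ k s → natMem s 4 ≡ k × Search T m D s × natMem s 3 ≡ toℕ v × Flag k (natMem s 5))
          (λ (k≡ , ((_ , _ , _ , _ , len) , _) , _) → k≡ , len)
          (≡.refl , search , v≡ , inj₁ (c≡ , λ u seen → contradiction seen seen-0))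
          body
          (λ where
            (_ , search , v≡ , inj₁ (c≡ , none)) → search , v≡ , inj₁ (c≡ , λ (u , u∈ , eq) → none u (∈⇒seen u∈) eq)
            (_ , search , v≡ , inj₂ (c≡ , cov))  → search , v≡ , inj₂ (c≡ , cov))
          where
          body : ∀ k s → k ℕ.< length T → _ → Ends _ s _
          body k s k<T (k≡ , search@((_ , _ , _ , holds , _) , _) , v≡ , flag) with split-at T k<T
          ... | as , u , bs , ≡.refl , ≡.refl = ends-if {b = sameCell (tourAt N[ nat 4 ]) N[ nat 3 ]}
            (λ t → ends-nat (≡.cong suc k≡ , search , v≡ , inj₂ (≡.refl , u , ∈-insert as , sameCell-true {s = s} {a = tourAt N[ nat 4 ]} {b = N[ nat 3 ]} u≡ v≡ t)))
            (λ f → ends-skip (≡.cong suc k≡ , search , v≡ , flag′ f flag))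
            where
            u≡ : evalN s (tourAt N[ nat 4 ]) ≡ toℕ u
            u≡ = ≡.trans (≡.cong (heap s) k≡) (holds-lookup 0 as holds)
            flag′ : evalB s (sameCell (tourAt N[ nat 4 ]) N[ nat 3 ]) ≡ false →
                    Flag (length as) (natMem s 5) → Flag (suc (length as)) (natMem s 5)
            flag′ f (inj₂ cov) = inj₂ cov
            flag′ f (inj₁ (c≡ , none)) = inj₁ (c≡ , λ u′ seen → new u′ (seen-suc as seen))
              where
              new : ∀ u′ → _ → cell u′ ≢ cell v
              new u′ (inj₁ seen)   = none u′ seen
              new u′ (inj₂ ≡.refl) = sameCell-false {s = s} {a = tourAt N[ nat 4 ]} {b = N[ nat 3 ]} u≡ v≡ f

        improveEdge-ends : ∀ {s} → Search T m D s → natMem s 3 ≡ toℕ v → ¬ Covered T v →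
          Ends improveEdge s (λ s′ → Search T m (λ u′ v′ → D u′ v′ ⊎ v′ ≡ v × u′ ∈ T) s′ × natMem s′ 3 ≡ toℕ v)
        improveEdge-ends (ctx@(_ , _ , g , _ , _) , near) v≡ v∉ = ends-for {r = 4} (length T) (greedy-length g)
          (λ k s → natMem s 4 ≡ k × Search T m (D′ k) s × natMem s 3 ≡ toℕ v)
          (λ (k≡ , ((_ , _ , _ , _ , len) , _) , _) → k≡ , len)
          (≡.refl , (ctx , nearest-⊆ (λ where (inj₁ d) _ → d
                                              (inj₂ (_ , seen)) _ → contradiction seen seen-0) near) , v≡)
          body
          (λ (_ , (ctx , near) , v≡) → (ctx , nearest-⊆ (λ where (inj₁ d) _ → inj₁ d
                                                                 (inj₂ (eq , u∈)) _ → inj₂ (eq , ∈⇒seen u∈)) near) , v≡)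
          where
          D′ : ℕ → Fin n → Fin n → Set
          D′ k u′ v′ = D u′ v′ ⊎ v′ ≡ v × Seen T k u′
          body : ∀ k s → k ℕ.< length T → _ → Ends _ s _
          body k s k<T (k≡ , (ctx@(_ , _ , _ , holds , _) , near) , v≡) with split-at T k<T
          ... | as , u , bs , ≡.refl , ≡.refl =
            ends-if {b = notᴮ (andᴮ (nat 1 ≤ᴺ N[ nat 6 ]) (R[ nat 0 ] ≤ᴿ edge (tourAt N[ nat 4 ]) N[ nat 3 ]))}
              (λ t → ends-seq (ends-nat (ends-seq (ends-nat (ends-seq (ends-nat (ends-real
                (≡.cong suc k≡ , (ctx , inj₂ (≡.refl , as , u , bs , v , ≡.refl , k≡ , v≡ , v∉ , edge≡ , better t near)) , v≡))))))))
              (λ f → ends-skip (≡.cong suc k≡ , (ctx , same (∧-true (not-false f)) near) , v≡))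
            where
            u≡ : evalN s (tourAt N[ nat 4 ]) ≡ toℕ u
            u≡ = ≡.trans (≡.cong (heap s) k≡) (holds-lookup 0 as holds)
            edge≡ : evalR s (edge (tourAt N[ nat 4 ]) N[ nat 3 ]) ≡ weight u v
            edge≡ = ≡.trans (atPoint-toℕ _ u≡) (atPoint-toℕ _ v≡)
            e = evalR s (edge (tourAt N[ nat 4 ]) N[ nat 3 ])
            new : ∀ {u′ v′} → D′ (suc (length as)) u′ v′ → D′ (length as) u′ v′ ⊎ v′ ≡ v × u′ ≡ u
            new (inj₁ d) = inj₁ (inj₁ d)
            new (inj₂ (eq , seen)) with seen-suc as seen
            ... | inj₁ seen′ = inj₁ (inj₂ (eq , seen′))
            ... | inj₂ eq′   = inj₂ (eq , eq′)
            better : not (does (1 ℕ.≤? natMem s 6) ∧ does (realMem s 0 ≤? e)) ≡ true →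
                     Nearest T (D′ (length as)) (natMem s 6) (natMem s 7) (natMem s 8) (realMem s 0) →
                     ∀ u′ v′ → D′ (suc (length as)) u′ v′ → ¬ Covered T v′ → e ≤ weight u′ v′
            better t near u′ v′ d v′∉ with new d
            ... | inj₂ (≡.refl , ≡.refl) = ≡.subst (e ≤_) edge≡ ≤-refl
            better t (inj₁ (_ , all)) u′ v′ d v′∉ | inj₁ d′ = contradiction (all u′ v′ d′) v′∉
            better t (inj₂ (f≡ , _ , _ , _ , _ , _ , _ , _ , _ , _ , all)) u′ v′ d v′∉ | inj₁ d′ = ≤-trans e≤ (all u′ v′ d′ v′∉)
              where
              -- Otherwise the old edge would be no heavier and the guard would have failed.
              e≤ : e ≤ realMem s 0
              e≤ with total e (realMem s 0)
              ... | inj₁ le = le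
              ... | inj₂ ge = contradiction (≡.trans (≡.sym t) (≡.cong not
                (≡.cong₂ _∧_ (dec-true (1 ℕ.≤? natMem s 6) (ℕ.≤-reflexive (≡.sym f≡))) (dec-true (realMem s 0 ≤? e) ge)))) λ ()
            same : (does (1 ℕ.≤? natMem s 6) ≡ true × does (realMem s 0 ≤? e) ≡ true) →
                   Nearest T (D′ (length as)) (natMem s 6) (natMem s 7) (natMem s 8) (realMem s 0) →
                   Nearest T (D′ (suc (length as))) (natMem s 6) (natMem s 7) (natMem s 8) (realMem s 0)
            same (f , _) (inj₁ (f≡ , _)) = contradiction (≡.subst (1 ℕ.≤_) f≡ (does-true (1 ℕ.≤? natMem s 6) f)) λ ()
            same (_ , t) (inj₂ (f≡ , xs , u₀ , ys , v₀ , eq , p , b , v∉ , w , all)) =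
              inj₂ (f≡ , xs , u₀ , ys , v₀ , eq , p , b , v∉ , w , λ u′ v′ d v′∉ → extend u′ v′ v′∉ (new d))
              where
              extend : ∀ u′ v′ → ¬ Covered T v′ → D′ (length as) u′ v′ ⊎ v′ ≡ v × u′ ≡ u → realMem s 0 ≤ weight u′ v′
              extend u′ v′ v′∉ (inj₁ d)                  = all u′ v′ d v′∉
              extend u′ v′ v′∉ (inj₂ (≡.refl , ≡.refl))  = ≡.subst (realMem s 0 ≤_) edge≡ (does-true (realMem s 0 ≤? e) t)

      module _ {T : List (Fin n)} {m : ℕ} where

        Below : ℕ → Fin n → Fin n → Set
        Below i u v = u ∈ T × toℕ v ℕ.< i

        nearestEdge-ends : ∀ {s} → Ctx T m s → Ends nearestEdge s (Search T m (λ u v → u ∈ T))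
        nearestEdge-ends ctx = ends-seq (ends-nat (ends-for {r = 3} n ℕ.≤-refl
          (λ i s → natMem s 3 ≡ i × Search T m (Below i) s)
          (λ (i≡ , _) → i≡ , ≡.refl)
          (≡.refl , ctx , inj₁ (≡.refl , λ u v → λ ()))
          body
          (λ (_ , ctx , near) → ctx , nearest-⊆ (λ {_} {v} u∈ _ → u∈ , Fin.toℕ<n v) near)))
          where
          body : ∀ i s → i ℕ.< n → _ → Ends _ s _
          body i s i<n (i≡ , search) = ends-seq (ends-nat (ends-seq (ends-mono after
            (markCovered-ends {T} {m} {Below i} {v} search (≡.trans i≡ (≡.sym v≡i)) ≡.refl))))
            where
            v = fromℕ< i<n
            v≡i : toℕ v ≡ i
            v≡i = Fin.toℕ-fromℕ< i<n
            extend : ∀ {u′ v′} → Below (suc i) u′ v′ → Below i u′ v′ ⊎ v′ ≡ v × u′ ∈ T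
            extend {v′ = v′} (u∈ , lt) with ℕ.m≤n⇒m<n∨m≡n (ℕ.≤-pred lt)
            ... | inj₁ lt′ = inj₁ (u∈ , lt′)
            ... | inj₂ eq  = inj₂ (Fin.toℕ-injective (≡.trans eq (≡.sym v≡i)) , u∈)
            after : ∀ {s} → Search T m (Below i) s × natMem s 3 ≡ toℕ v ×
                      (natMem s 5 ≡ 0 × ¬ Covered T v ⊎ natMem s 5 ≡ 1 × Covered T v) →
                    Ends (if′ N[ nat 5 ] ≤ᴺ nat 0 then′ improveEdge else′ skip) s _
            after {s} (search , v≡ , inj₁ (c≡ , v∉)) = ends-if {b = N[ nat 5 ] ≤ᴺ nat 0}
              (λ _ → ends-mono (λ ((ctx , near) , v≡) → ≡.cong suc (≡.trans v≡ v≡i) , ctx , nearest-⊆ (λ d _ → extend d) near)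
                (improveEdge-ends {T} {m} {Below i} {v} search v≡ v∉))
              (λ f → contradiction (ℕ.≤-reflexive c≡) (does-false (_ ℕ.≤? 0) f))
            after {s} ((ctx , near) , v≡ , inj₂ (c≡ , cov)) = ends-if {b = N[ nat 5 ] ≤ᴺ nat 0}
              (λ t → contradiction (≡.subst (ℕ._≤ 0) c≡ (does-true (_ ℕ.≤? 0) t)) λ ())
              (λ _ → ends-skip (≡.cong suc (≡.trans v≡ v≡i) , ctx , nearest-⊆ (λ d v′∉ → only d v′∉ (extend d)) near))
              where
              only : ∀ {u′ v′} → Below (suc i) u′ v′ → ¬ Covered T v′ → Below i u′ v′ ⊎ v′ ≡ v × u′ ∈ T → Below i u′ v′
              only _ v′∉ (inj₁ d)             = d
              only _ v′∉ (inj₂ (≡.refl , _))  = contradiction cov v′∉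

      module Insertion (xs : List (Fin n)) (u : Fin n) (ys : List (Fin n)) (v : Fin n) (m : ℕ)
                       (fits : length (xs ++ u ∷ v ∷ ys) ℕ.≤ n) where

        T T′ : List (Fin n)
        T  = xs ++ u ∷ ys
        T′ = xs ++ u ∷ v ∷ ys

        Frame : State → Set
        Frame s = Outer s × natMem s 2 ≡ m × Greedy r T (realMem s 1) × realMem s 0 ≡ weight u v × natMem s 9 ≡ length T′

        -- The first pending point is carried by register 12; the others are
        -- still one position before their final one.
        Pending : (ℕ → ℕ) → ℕ → ℕ → List (Fin n) → Set
        Pending h c j []       = ⊤
        Pending h c j (x ∷ zs) = c ≡ toℕ x × Holds h j zs

        Shifting : ℕ → State → Set
        Shifting k s = ∃ λ pre → ∃ λ ps → pre ++ ps ≡ T′ × length ps ≡ k × Frame s × natMem s 11 ≡ length pre ×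
          Holds (heap s) 0 pre × Pending (heap s) (natMem s 12) (length pre) ps

        shift-ends : ∀ {s} k → k ℕ.≤ n → Shifting k s →
                     Ends (while′ nat 1 ⊕ N[ nat 11 ] ≤ᴺ N[ nat 9 ] do′ shiftOne) s (Shifting 0)
        shift-ends = ends-while Shifting body exit
          where
          exit : ∀ s → Shifting 0 s → evalB s (nat 1 ⊕ N[ nat 11 ] ≤ᴺ N[ nat 9 ]) ≡ false
          exit s (pre , [] , eq , _ , (_ , _ , _ , _ , len) , j≡ , _) = dec-false (_ ℕ.≤? _)
            (λ le → ℕ.1+n≰n (≡.subst₂ (λ a b → suc a ℕ.≤ b) j≡
              (≡.trans len (≡.cong length (≡.trans (≡.sym eq) (List.++-identityʳ pre)))) le))
          body : ∀ k s → Shifting (suc k) s →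
                 evalB s (nat 1 ⊕ N[ nat 11 ] ≤ᴺ N[ nat 9 ]) ≡ true × Ends shiftOne s (Shifting k)
          body k s (pre , x ∷ zs , eq , ≡.refl , ((root≡ , best) , frame@(_ , _ , _ , len)) , j≡ , holds , c≡ , pending) =
            dec-true (_ ℕ.≤? _) (≡.subst₂ (λ a b → suc a ℕ.≤ b) (≡.sym j≡) (≡.sym len) j<) ,
            ends-seq (ends-nat (ends-seq (ends-nat (ends-seq (ends-nat (ends-nat
              (pre ++ [ x ] , zs , ≡.trans (List.++-assoc pre [ x ] zs) eq , ≡.refl ,
               -- By `fits` the written position lies below `n`, outside the saved tour.
               ((root≡ , best-write (≡.subst (ℕ._< n) (≡.sym j≡) (ℕ.<-≤-trans j< fits)) best) , frame) ,
               ≡.trans (≡.cong suc j≡) (≡.sym length-snoc) ,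
               ≡.subst₂ (λ a c → Holds (heap s [ a ↦ c ]) 0 (pre ++ [ x ])) (≡.sym j≡) (≡.sym c≡) (holds-snoc 0 pre holds) ,
               pending′ zs pending)))))))
            where
            length-snoc : length (pre ++ [ x ]) ≡ suc (length pre)
            length-snoc = ≡.trans (List.length-++ pre) (ℕ.+-comm (length pre) 1)
            j< : length pre ℕ.< length T′
            j< = ≡.subst (length pre ℕ.<_) (≡.trans (≡.sym (List.length-++ pre)) (≡.cong length eq)) (ℕ.m<m+n (length pre) ℕ.z<s)
            pending′ : ∀ zs → Holds (heap s) (length pre) zs →
                       Pending (heap s [ natMem s 11 ↦ natMem s 12 ]) (heap s (natMem s 11)) (length (pre ++ [ x ])) zs
            pending′ []       _             = tt
            pending′ (z ∷ zs) (z≡ , pending) = ≡.trans (≡.cong (heap s) j≡) z≡ ,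
              ≡.subst (λ j → Holds _ j zs) (≡.sym length-snoc)
                (holds-write-before (suc (length pre)) zs (ℕ.s≤s (ℕ.≤-reflexive j≡)) pending)

        insert-ends : ∀ {s} → Ctx T m s → natMem s 7 ≡ length xs → natMem s 8 ≡ toℕ v → realMem s 0 ≡ weight u v →
                      (∀ {M} → Greedy r T M → Greedy r T′ (M + weight u v)) → Ends insertPoint s (Ctx T′ m)
        insert-ends {s} (outer , round≡ , g , holds , len) pos≡ v≡ w≡ grows =
          ends-seq (ends-nat (ends-seq (ends-nat (ends-seq (ends-nat (ends-seq (ends-mono finish
            (shift-ends (length (v ∷ ys)) pending≤n
              -- Everything up to `u` is in place already; `v` is carried, and `ys` waits one
              -- position too early.
              (xs ++ [ u ] , v ∷ ys , List.++-assoc xs [ u ] (v ∷ ys) , ≡.refl ,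
               (outer , round≡ , g , w≡ , ≡.trans (≡.cong suc len) (≡.sym length-insert)) ,
               ≡.trans (≡.cong suc pos≡) (≡.sym length-snoc) ,
               proj₁ parts , v≡ , proj₂ parts)))))))))
          where
          parts = holds-split 0 (xs ++ [ u ]) (≡.subst (Holds (heap s) 0) (≡.sym (List.++-assoc xs [ u ] ys)) holds)
          length-insert : length T′ ≡ suc (length T)
          length-insert = ↭-length (insert-↭ xs u v ys)
          length-snoc : length (xs ++ [ u ]) ≡ suc (length xs)
          length-snoc = ≡.trans (List.length-++ xs) (ℕ.+-comm (length xs) 1)
          pending≤n : length (v ∷ ys) ℕ.≤ n
          pending≤n = ℕ.≤-trans (ℕ.≤-trans (ℕ.m≤n+m _ (length xs ℕ.+ 1)) (ℕ.≤-reflexive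
            (≡.trans (ℕ.+-assoc (length xs) 1 _) (≡.sym (List.length-++ xs))))) fits
          finish : ∀ {s} → Shifting 0 s → Ends (R[ nat 1 ]≔ R[ nat 1 ] ⊕ R[ nat 0 ]) s (Ctx T′ m)
          finish {s} (pre , [] , eq , _ , (outer , round≡ , g , w≡ , len) , _ , holds , _) = ends-real
            (outer , round≡ , ≡.subst (λ d → Greedy r T′ (realMem s 1 + d)) (≡.sym w≡) (grows g) ,
             ≡.subst (Holds (heap s) 0) (≡.trans (≡.sym (List.++-identityʳ pre)) eq) holds , len)

      Growth : ℕ → State → Set
      Growth m s = ∃ λ T → Ctx T m s × ((∀ v → Covered T v) ⊎ m ℕ.< length T)

      growTour-ends : ∀ {s} → Outer s → Ends growTour s (λ s′ → Outer s′ ×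
        ∃ λ T → Full r T (realMem s′ 1) × Holds (heap s′) 0 T × natMem s′ 9 ≡ length T)
      growTour-ends {s} (root≡ , best) = ends-seq (ends-nat (ends-seq (ends-nat (ends-seq (ends-real
        (ends-for {r = 2} n ℕ.≤-refl Growth
          (λ (_ , (_ , m≡ , _) , _) → m≡ , ≡.refl)
          ([ r ] , ((root≡ , best-write (ℕ.≤-trans (ℕ.s≤s ℕ.z≤n) (Fin.toℕ<n r)) best) , ≡.refl , root , (root≡ , tt) , ≡.refl) , inj₂ (ℕ.s≤s ℕ.z≤n))
          body (λ {s} → final {s})))))))
        where
        final : ∀ {s} → Growth n s → Outer s × ∃ λ T → Full r T (realMem s 1) × Holds (heap s) 0 T × natMem s 9 ≡ length T
        final (T , (outer , _ , g , holds , len) , inj₁ all) = outer , T , (g , all) , holds , len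
        final (T , (outer , _ , g , holds , len) , inj₂ lt)  = contradiction (ℕ.<-≤-trans lt (greedy-length g)) (ℕ.<-irrefl ≡.refl)
        body : ∀ m s → m ℕ.< n → Growth m s → Ends _ s _
        body m s m<n (T , ctx , progress) = ends-seq (ends-mono after (nearestEdge-ends {T} ctx))
          where
          bump : ∀ {s T} → Ctx T m s → Ctx T (suc m) ⟨ natMem s [ 2 ↦ suc (natMem s 2) ] , realMem s ⟩
          bump (outer , m≡ , g , holds , len) = outer , ≡.cong suc m≡ , g , holds , len
          after : ∀ {s} → Search T m (λ u v → u ∈ T) s →
            Ends (if′ nat 1 ≤ᴺ N[ nat 6 ] then′ insertPoint else′ skip) s
              (λ s′ → Growth (suc m) ⟨ natMem s′ [ 2 ↦ suc (natMem s′ 2) ] , realMem s′ ⟩)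
          after {s} (ctx@(_ , _ , g , _) , inj₁ (f≡ , all)) = ends-if {b = nat 1 ≤ᴺ N[ nat 6 ]}
            (λ t → contradiction (≡.subst (1 ℕ.≤_) f≡ (does-true (1 ℕ.≤? _) t)) λ ())
            (λ _ → ends-skip (T , bump {s} ctx , inj₁ (λ v → all r v (greedy-root g))))
          after {s} (ctx@(_ , _ , g , _) , inj₂ (f≡ , xs , u , ys , v , ≡.refl , pos≡ , v≡ , v∉ , w≡ , nearest)) =
            ends-if {b = nat 1 ≤ᴺ N[ nat 6 ]}
              (λ _ → ends-mono (λ {s′} ctx′ → xs ++ u ∷ v ∷ ys , bump {s′} ctx′ , inj₂ (longer progress))
                (Insertion.insert-ends xs u ys v m (greedy-length (grows g)) ctx pos≡ v≡ w≡ grows))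
              (λ f → contradiction (ℕ.≤-reflexive (≡.sym f≡)) (does-false (1 ℕ.≤? _) f))
            where
            grows : ∀ {M} → Greedy r T M → Greedy r (xs ++ u ∷ v ∷ ys) (M + weight u v)
            grows g = grow g v∉ (λ u′ v′ u′∈ v′∉ → ≡.subst (_≤ weight u′ v′) w≡ (nearest u′ v′ u′∈ v′∉))
            longer : (∀ v → Covered T v) ⊎ m ℕ.< length T → suc m ℕ.< length (xs ++ u ∷ v ∷ ys)
            longer (inj₁ all) = contradiction (all v) v∉
            longer (inj₂ lt)  = ≡.subst (suc m ℕ.<_) (≡.sym (↭-length (insert-↭ xs u v ys))) (ℕ.s≤s lt)

      saveTour-ends : ∀ {s T} → Outer s → Full r T (realMem s 1) → Holds (heap s) 0 T → natMem s 9 ≡ length T →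
        Ends saveTour s (λ s′ → natMem s′ 1 ≡ toℕ r × BestSoFar (suc (toℕ r)) (natMem s′ 10) (heap s′) (realMem s′ 2))
      saveTour-ends {s} {T} (root≡ , best) full@(g , _) holds len = ends-if
        {b = notᴮ (andᴮ (nat 1 ≤ᴺ N[ nat 10 ]) (R[ nat 2 ] ≤ᴿ R[ nat 1 ]))}
        (λ t → ends-seq (ends-nat (ends-seq (ends-real (ends-seq (ends-nat (ends-for {r = 4} (length T) T≤n
          Copied
          (λ (k≡ , _ , len , _) → k≡ , len)
          (≡.refl , root≡ , len , ≡.refl , ≡.refl , ≡.trans (↦-same (heap s) n _) len ,
           holds-write-after 0 T T≤n holds , [] , T , ≡.refl , ≡.refl , tt)
          copy
          (λ {s′} → saved (beats t best) {s′}))))))))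
        (λ f → ends-skip (root≡ , keep (∧-true (not-false f)) best))
        where
        T≤n : length T ℕ.≤ n
        T≤n = greedy-length g
        Copied : ℕ → State → Set
        Copied k s′ = natMem s′ 4 ≡ k × natMem s′ 1 ≡ toℕ r × natMem s′ 9 ≡ length T × natMem s′ 10 ≡ 1 ×
          realMem s′ 2 ≡ realMem s 1 × heap s′ n ≡ length T × Holds (heap s′) 0 T ×
          ∃ λ pre → ∃ λ post → pre ++ post ≡ T × length pre ≡ k × Holds (heap s′) (suc n) pre
        saved : Beats (suc (toℕ r)) (realMem s 1) → ∀ {s′} → Copied (length T) s′ →
                natMem s′ 1 ≡ toℕ r × BestSoFar (suc (toℕ r)) (natMem s′ 10) (heap s′) (realMem s′ 2)
        saved beats {s′} (_ , root≡ , _ , one , M≡ , len , _ , pre , [] , eq , _ , holds) = root≡ , inj₂ (one ,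
          ≡.subst (Saved (suc (toℕ r)) (heap s′)) (≡.sym M≡) (r , T , full , len ,
            ≡.subst (Holds (heap s′) (suc n)) (≡.trans (≡.sym (List.++-identityʳ pre)) eq) holds , beats))
        saved beats (_ , _ , _ , _ , _ , _ , _ , pre , x ∷ post , eq , len , _) = contradiction
          (≡.trans len (≡.trans (≡.cong length (≡.sym eq)) (List.length-++ pre)))
          (ℕ.<⇒≢ (ℕ.m<m+n (length pre) ℕ.z<s))
        copy : ∀ k s′ → k ℕ.< length T → Copied k s′ → Ends _ s′ _
        copy k s′ k<T (_ , _ , _ , _ , _ , _ , _ , pre , [] , eq , ≡.refl , _) = contradiction
          (≡.cong length (≡.trans (≡.sym (List.++-identityʳ pre)) eq)) (ℕ.<⇒≢ k<T)
        copy k s′ k<T (k≡ , root≡ , len , one , M≡ , h≡ , holds , pre , x ∷ post , eq , ≡.refl , saved) = ends-nat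
          (≡.cong suc k≡ , root≡ , len , one , M≡ ,
           ≡.trans (↦-other (heap s′) (ℕ.<⇒≢ (ℕ.s≤s (ℕ.m≤m+n n _)))) h≡ ,
           holds-write-after 0 T (ℕ.≤-trans T≤n (ℕ.m≤n⇒m≤1+n (ℕ.m≤m+n n _))) holds ,
           pre ++ [ x ] , post , ≡.trans (List.++-assoc pre [ x ] post) eq ,
           ≡.trans (List.length-++ pre) (ℕ.+-comm (length pre) 1) ,
           ≡.subst₂ (λ a c → Holds (heap s′ [ a ↦ c ]) (suc n) (pre ++ [ x ])) (≡.cong (λ j → suc (n ℕ.+ j)) (≡.sym k≡)) (≡.sym x≡)
             (holds-snoc (suc n) pre saved))
          where
          x≡ : heap s′ (natMem s′ 4) ≡ toℕ x
          x≡ = ≡.trans (≡.cong (heap s′) k≡) (holds-lookup 0 pre (≡.subst (Holds (heap s′) 0) (≡.sym eq) holds))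
        self : ∀ {M} r′ → M ≤ realMem s 1 → toℕ r′ ≡ toℕ r → ∃ λ T → ∃ λ M′ → Full r′ T M′ × M ≤ M′
        self r′ M≤ eq = T , realMem s 1 , ≡.subst (λ r → Full r T (realMem s 1)) (Fin.toℕ-injective (≡.sym eq)) full , M≤
        beats : not (does (1 ℕ.≤? natMem s 10) ∧ does (realMem s 2 ≤? realMem s 1)) ≡ true →
                BestSoFar (toℕ r) (natMem s 10) (heap s) (realMem s 2) → Beats (suc (toℕ r)) (realMem s 1)
        beats t best r′ lt with ℕ.m≤n⇒m<n∨m≡n (ℕ.≤-pred lt)
        ... | inj₂ eq = self r′ ≤-refl eq
        beats t (inj₁ (_ , r≡0)) r′ lt | inj₁ r′<r = contradiction (≡.subst (toℕ r′ ℕ.<_) r≡0 r′<r) λ ()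
        beats t (inj₂ (one , _ , _ , _ , _ , _ , earlier)) r′ lt | inj₁ r′<r with total (realMem s 1) (realMem s 2) | earlier r′ r′<r
        ... | inj₁ le | T′ , M′ , full′ , M≤ = T′ , M′ , full′ , ≤-trans le M≤
        ... | inj₂ ge | _ = contradiction (≡.trans (≡.sym t) (≡.cong not
                (≡.cong₂ _∧_ (dec-true (1 ℕ.≤? natMem s 10) (ℕ.≤-reflexive (≡.sym one))) (dec-true (_ ≤? _) ge)))) λ ()
        keep : does (1 ℕ.≤? natMem s 10) ≡ true × does (realMem s 2 ≤? realMem s 1) ≡ true →
               BestSoFar (toℕ r) (natMem s 10) (heap s) (realMem s 2) →
               BestSoFar (suc (toℕ r)) (natMem s 10) (heap s) (realMem s 2)
        keep (f , _) (inj₁ (zero≡ , _)) = contradiction (≡.subst (1 ℕ.≤_) zero≡ (does-true (1 ℕ.≤? _) f)) λ ()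
        keep (_ , t) (inj₂ (one , r₀ , T₀ , full₀ , len₀ , holds₀ , earlier)) = inj₂ (one , r₀ , T₀ , full₀ , len₀ , holds₀ , later)
          where
          later : Beats (suc (toℕ r)) (realMem s 2)
          later r′ lt with ℕ.m≤n⇒m<n∨m≡n (ℕ.≤-pred lt)
          ... | inj₁ r′<r = earlier r′ r′<r
          ... | inj₂ eq   = self r′ (does-true (_ ≤? _) t) eq

    -- Output and the whole program

    returnTour-ends : ∀ {s Mb} → Saved n (heap s) Mb →
      Ends returnTour s (λ s′ → ∃ λ r → ∃ λ T → Full r T Mb × Beats n Mb × output s′ ≡ map toℕ T)
    returnTour-ends {s} (r , T , full@(g , _) , len , holds , beats) = ends-for {r = 0} (length T) T≤n Copied
      (λ (k≡ , len , _) → k≡ , len)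
      (≡.refl , len , holds , [] , T , ≡.refl , ≡.refl , tt)
      copy
      (λ {s′} c → r , T , full , beats , done {s′} c)
      where
      T≤n : length T ℕ.≤ n
      T≤n = greedy-length g
      Copied : ℕ → State → Set
      Copied k s′ = natMem s′ 0 ≡ k × heap s′ n ≡ length T × Holds (heap s′) (suc n) T ×
        ∃ λ pre → ∃ λ post → pre ++ post ≡ T × length pre ≡ k × Holds (natMem s′) 1 pre
      done : ∀ {s′} → Copied (length T) s′ → output s′ ≡ map toℕ T
      done {s′} (k≡ , _ , _ , pre , [] , eq , _ , holds) =
        ≡.trans (≡.cong (λ k → map (λ j → natMem s′ (suc j)) (upTo k)) k≡)
          (≡.trans (List.map-upTo (λ j → natMem s′ (suc j)) (length T))
            (holds-output T (≡.subst (Holds (natMem s′) 1) (≡.trans (≡.sym (List.++-identityʳ pre)) eq) holds) (λ _ → ≡.refl)))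
      done (_ , _ , _ , pre , x ∷ post , eq , len , _) = contradiction
        (≡.trans len (≡.trans (≡.cong length (≡.sym eq)) (List.length-++ pre)))
        (ℕ.<⇒≢ (ℕ.m<m+n (length pre) ℕ.z<s))
      copy : ∀ k s′ → k ℕ.< length T → Copied k s′ → Ends _ s′ _
      copy k s′ k<T (_ , _ , _ , pre , [] , eq , ≡.refl , _) = contradiction
        (≡.cong length (≡.trans (≡.sym (List.++-identityʳ pre)) eq)) (ℕ.<⇒≢ k<T)
      copy k s′ k<T (k≡ , len , saved , pre , x ∷ post , eq , ≡.refl , holds) = ends-nat
        (≡.cong suc k≡ ,
         ≡.trans (↦-other (natMem s′) (ℕ.<⇒≢ (below ℕ.≤-refl) ∘ ≡.sym)) len ,
         holds-cong (suc n) T (λ j n<j _ → ↦-other (natMem s′) (ℕ.<⇒≢ (below (ℕ.<⇒≤ n<j)) ∘ ≡.sym)) saved ,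
         pre ++ [ x ] , post , ≡.trans (List.++-assoc pre [ x ] post) eq ,
         ≡.trans (List.length-++ pre) (ℕ.+-comm (length pre) 1) ,
         holds-write-before 1 (pre ++ [ x ]) (ℕ.s≤s ℕ.z≤n)
           (≡.subst₂ (λ a c → Holds (natMem s′ [ a ↦ c ]) 1 (pre ++ [ x ])) (≡.cong suc (≡.sym k≡)) (≡.sym x≡) (holds-snoc 1 pre holds)))
        where
        -- The output may overwrite registers and the working tour, but it ends at address `n` at
        -- the latest, while the saved tour begins beyond `16 + n`.
        below : ∀ {j} → n ℕ.≤ j → suc (natMem s′ 0) ℕ.< 16 ℕ.+ j
        below {j} n≤j = ℕ.s≤s (ℕ.≤-trans (≡.subst (ℕ._≤ n) (≡.cong suc (≡.sym k≡)) (ℕ.≤-trans k<T T≤n)) (ℕ.≤-trans n≤j (ℕ.m≤n+m j 15)))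
        x≡ : heap s′ (suc (n ℕ.+ natMem s′ 0)) ≡ toℕ x
        x≡ = ≡.trans (≡.cong (λ j → heap s′ (suc (n ℕ.+ j))) k≡)
          (holds-lookup (suc n) pre (≡.subst (Holds (heap s′) (suc n)) (≡.sym eq) saved))

    greedyProgram-ends : Ends greedyProgram initial (λ s′ → ∃ λ r → ∃ λ T → ∃ λ Mb →
      Full r T Mb × Beats n Mb × output s′ ≡ map toℕ T)
    greedyProgram-ends = ends-seq (ends-for {r = 1} n ℕ.≤-refl
      (λ i s → natMem s 1 ≡ i × BestSoFar i (natMem s 10) (heap s) (realMem s 2))
      (λ (i≡ , _) → i≡ , ≡.refl)
      (≡.refl , inj₁ (≡.refl , ≡.refl))
      body finish)
      where
      body : ∀ i s → i ℕ.< n → natMem s 1 ≡ i × BestSoFar i (natMem s 10) (heap s) (realMem s 2) → Ends _ s _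
      body i s i<n (i≡ , best) = ends-seq (ends-mono
        (λ (outer , T , full , holds , len) → ends-mono
          (λ {s′} (r≡ , best′) → ≡.cong suc (≡.trans r≡ (Fin.toℕ-fromℕ< i<n)) ,
            ≡.subst (λ j → BestSoFar (suc j) (natMem s′ 10) (heap s′) (realMem s′ 2)) (Fin.toℕ-fromℕ< i<n) best′)
          (Growing.saveTour-ends (fromℕ< i<n) outer full holds len))
        (Growing.growTour-ends (fromℕ< i<n) (≡.trans i≡ (≡.sym (Fin.toℕ-fromℕ< i<n)) ,
          ≡.subst (λ j → BestSoFar j (natMem s 10) (heap s) (realMem s 2)) (≡.sym (Fin.toℕ-fromℕ< i<n)) best)))
      finish : ∀ {s} → natMem s 1 ≡ n × BestSoFar n (natMem s 10) (heap s) (realMem s 2) → Ends returnTour s _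
      -- Having saved nothing would mean an instance without points.
      finish (_ , inj₁ (_ , n≡0)) = contradiction (≡.subst Fin n≡0 (proj₁ threeCells)) λ ()
      finish (_ , inj₂ (_ , saved)) = ends-mono (λ (r , T , full , beats , out) → r , T , _ , full , beats , out) (returnTour-ends saved)

    -- Feasibility and the ratio

    module _ {r T M} (full : Full r T M) where
      private
        g = proj₁ full

      tour : Cycle I
      tour = record
        { vertices = T
        ; unique   = Unique.map⁻ (greedy-unique g)
        ; 3≤length = let (i , j , k , i≢j , j≢k , i≢k) = threeCells in
            unique-cells⇒length-≤ {i ∷ j ∷ k ∷ []} ((i≢j ∷ i≢k ∷ []) ∷ (j≢k ∷ []) ∷ [] ∷ []) (λ {u} _ → proj₂ full u)
        }

      tour-feasible : Feasible I tour
      tour-feasible c (i , ≡.refl) = let (u , u∈T , eq) = proj₂ full i in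
        u , (u∈T , eq) , λ (v∈T , eq′) → same-cell (greedy-unique g) u∈T v∈T (≡.trans eq (≡.sym eq′))

    tour-ratio : ∀ {ε} → 0# ≤ ε → ∀ {r T M} → (full : Full r T M) → Beats n M → ∀ C → Feasible I C →
      w I (tour full) ≤ ((fromℕ 3 * fromℕ 2 ⁻¹ + fromℕ 8 * √ (fromℕ 2)) + ε) * w I C
    tour-ratio 0≤ε full beats record { vertices = [] ; 3≤length = () }
    tour-ratio 0≤ε {M = M} full beats record { vertices = s ∷ us ; unique = C! } feasible = begin
      w I (tour full)                       ≤⟨ greedy-weight (proj₁ full) ⟩
      M + M                                 ≤⟨ +-mono-≤ M≤M′ M≤M′ ⟩
      M′ + M′                               ≤⟨ Comparison.greedy-ratio s us cells! covers g′ ⟩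
      (2# + fromℕ 7 * √ 2#) * L             ≤⟨ *-mono-≤ 0≤ratio 0≤L (ratio-≤ 0≤ε) ≤-refl ⟩
      _ * L                                 ∎
      where
      open ≤-Reasoning
      -- The compared tour is listed from `s`, so the greedy tour with root `s` is the one that it
      -- bounds; the saved weight is no larger.
      better = beats s (Fin.toℕ<n s)
      M′     = proj₁ (proj₂ better)
      g′     = proj₁ (proj₁ (proj₂ (proj₂ better)))
      M≤M′   = proj₂ (proj₂ (proj₂ better))
      cells! : Unique (map cell (s ∷ us))
      cells! = unique-map cell (λ {x} {y} x∈ y∈ eq → let (_ , _ , uniq) = feasible (cell y) (y , ≡.refl) in
        ≡.trans (≡.sym (uniq (x∈ , eq))) (uniq (y∈ , ≡.refl))) C!
      covers : ∀ v → Covered (s ∷ us) v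
      covers v = let (u , (u∈ , eq) , _) = feasible (cell v) (v , ≡.refl) in u , u∈ , eq
      L = cyclicWeight I (s ∷ us)
      0≤L : 0# ≤ L
      0≤L = ≤-trans (path-nonneg s (us ++ [ s ])) (≤-reflexive (sym (cyclicWeight≈path s us)))
      0≤ratio : 0# ≤ 2# + fromℕ 7 * √ 2#
      0≤ratio = +-nonneg (fromℕ-nonneg 2) (*-nonneg _ _ (fromℕ-nonneg 7) (√-nonneg 2# (fromℕ-nonneg 2)))

    approximates : ∀ {ε} → 0# ≤ ε →
      Ends greedyProgram initial (λ s → ∃ λ r → ∃ λ T → ∃ λ M → Full r T M × Beats n M × output s ≡ map toℕ T) →
      ∃ λ t → ∃ λ C → t ℕ.≤ cost n greedyProgram × Outputs greedyProgram I t C × Feasible I C ×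
        (∀ C′ → Optimal I C′ → w I C ≤ ((fromℕ 3 * fromℕ 2 ⁻¹ + fromℕ 8 * √ (fromℕ 2)) + ε) * w I C′)
    approximates 0≤ε (t , s , t≤ , run , r , T , M , full , beats , out) =
      t , tour full , t≤ , (s , run , out) , tour-feasible full , λ C optimal → tour-ratio 0≤ε full beats C (proj₁ optimal)

-- With the polynomial bound as an argument, `a` and `d` are variables here instead of numbers
-- computed from the program.
greedy-approximates : (ℝ : RealNumbers) →
    let open RealNumbers ℝ in let open GGTSP ℝ in
    ∀ {ε} → 0# ≤ ε →
    (∃ λ a → ∃ λ d → ∀ n → 1 ℕ.≤ n → cost n greedyProgram ℕ.≤ a ℕ.* n ℕ.^ d) →
    IsApproximationAlgorithm ((fromℕ 3 * fromℕ 2 ⁻¹ + fromℕ 8 * √ (fromℕ 2)) + ε) greedyProgram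
greedy-approximates ℝ 0≤ε (a , d , cost≤) = a , d , λ I →
  let (t , C , t≤ , rest) = OverReals.OnInstance.approximates ℝ I 0≤ε (OverReals.OnInstance.greedyProgram-ends ℝ I)
      1≤n = ℕ.≤-trans (ℕ.s≤s ℕ.z≤n) (Fin.toℕ<n (proj₁ (GGTSP.Instance.threeCells I)))
  in t , C , ℕ.≤-trans t≤ (cost≤ (GGTSP.Instance.n I) 1≤n) , rest

mainTheorem2 : (ℝ : RealNumbers) →
    let open RealNumbers ℝ in let open GGTSP ℝ in
    ∀ (ε : Carrier) → 0# < ε →
    ∃ λ (p : Program) →
    IsApproximationAlgorithm
    ((fromℕ 3 * fromℕ 2 ⁻¹ + fromℕ 8 * √ (fromℕ 2)) + ε) p
mainTheorem2 ℝ ε (0≤ε , _) = greedyProgram , greedy-approximates ℝ 0≤ε (cost-polynomial greedyProgram)
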